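{- For every $n\ge1$ and every $\pi\in\mathrm{PC}(n)$ let $a(\pi)\in\mathbb{C}$ be an arbitrary complex number, and let $c(\pi)$ (for $\pi\in\mathrm{CO}(n)$) and $d(\pi)$ (for $\pi\in\mathcal{P}(n)$) be the associated weights described in the context. Let $$C(x)=\sum_{n=1}^\infty c_nx^n,\quad c_n=\sum_{\pi\in\mathrm{CO}(n)}c(\pi),\qquad D(x)=1+\sum_{n=1}^\infty d_nx^n,\quad d_n=\sum_{\pi\in\mathcal{P}(n)}d(\pi).$$ Then, as formal power series, $$D(x)=1+C(xD(x)).$$ Moreover, letting $F(x)=xD(x)$ and letting $F^{\langle-1\rangle}$ denote the inverse of $F$ with respect to composition, one has $$F^{\langle-1\rangle}(w)=\frac{w}{1+C(w)}.$$
   Context: $[n]=\{1,\ldots,n\}$ and $\mathcal{P}(n)$ is the set of all set partitions of $[n]$. $\mathrm{NC}(n)\subseteq\mathcal{P}(n)$ is the set of noncrossing partitions. For $\pi\in\mathcal{P}(n)$, write $i\overset{\pi}{\sim}j$ if $i,j$ lie in the same block of $\pi$. A subset $S\subseteq[n]$ splits $\pi$ if $S$ is a union of some of the blocks of $\pi$. Consider, for $\pi\in\mathcal{P}(n)$, $n\ge1$, the conditions: (a) no proper subinterval $\{p+1,p+2,\ldots,p+q\}$ of $[n]$ (with $0\le p<p+q\le n$ and $q<n$) splits $\pi$; (b) $k\not\overset{\pi}{\sim}k+1$ for all $k\in[n-1]$; (c) $1\not\overset{\pi}{\sim}n$. $\mathrm{PC}(n)$ is the set of $\pi\in\mathcal{P}(n)$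 satisfying (a), (b), (c); $\mathrm{PC}^+(n)$ is the set of those satisfying (a) and (b); $\mathrm{CO}(n)$ (connected partitions) is the set of those satisfying (a). Weights $b$: $0_1$ denotes the unique partition of $[1]$. One has $\mathrm{PC}^+(1)=\{0_1\}$ and, for $n\ge2$, $\mathrm{PC}^+(n)$ is the disjoint union of $\mathrm{PC}(n)$ and $\{\tilde\sigma\mid\sigma\in\mathrm{PC}(n-1)\}$, where $\tilde\sigma$ is obtained from $\sigma$ by adjoining $n$ to the block of $\sigma$ that contains $1$. Put $b(0_1)=1$ and, for $n\ge2$, $b(\pi)=a(\pi)$ if $\pi\in\mathrm{PC}(n)$ and $b(\tilde\sigma)=a(\sigma)$ for $\sigma\in\mathrm{PC}(n-1)$. Weights $c$: for $1\le\ell\le n$, $\sigma\in\mathrm{PC}^+(\ell)$ and integers $k_1,\ldots,k_\ell\ge1$ with $k_1+\cdots+k_\ell=n$, let $I_j=\{k_1+\cdots+k_{j-1}+1,\ldots,k_1+\cdots+k_{j-1}+k_j\}$ and $\Phi_n(\sigma,k_1,\ldots,k_\ell)=\{\bigcup_{j\in S}I_j\mid S\in\sigma\}$. The map $\Phi_n$ is a bijection from the set of all such tuples (over all $1\le\ell\le n$) onto $\mathrm{CO}(n)$. Put $c(\pi)=b(\sigma)$ for $\pi\in\mathrm{CO}(n)$, where $\pi=\Phi_n(\sigma,k_1,\ldots,k_\ell)$. Weights $d$: for $\tau=\{B_1,\ldots,B_{|\tau|}\}\in\mathrm{NC}(n)$ (blocks listed in order of increasing minimal elements) and $\sigma_j\in\mathrm{CO}(|B_j|)$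 for $1\le j\le|\tau|$, let $\Psi_n(\tau,\sigma_1,\ldots,\sigma_{|\tau|})=\bigcup_{j=1}^{|\tau|}\psi_{B_j}(\sigma_j)$, where $\psi_B:\{1,\ldots,|B|\}\to B$ is the order-preserving bijection and $\psi_{B}(\sigma)$ is the partition of $B$ obtained by applying $\psi_B$ to every block of $\sigma$. The map $\Psi_n$ is a bijection from the set of all such tuples $(\tau,\sigma_1,\ldots,\sigma_{|\tau|})$ onto $\mathcal{P}(n)$. Put $d(\pi)=\prod_{j=1}^{|\tau|}c(\sigma_j)$ for $\pi=\Psi_n(\tau,\sigma_1,\ldots,\sigma_{|\tau|})$. -}

module Defs where

open import Algebra.Bundles using (CommutativeRing)
open import Data.Bool.Base using (if_then_else_)
import Data.Bool.Properties as Bool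
open import Data.Fin.Base as Fin using (Fin; zero; suc; toℕ)
import Data.Fin.Properties as Fin
open import Data.Fin.Subset using (Subset; inside; outside; _∈_; _∩_; ⁅_⁆; ∣_∣; Nonempty; Empty)
open import Data.Fin.Subset.Properties using (_∈?_; nonempty?; anySubset?)
open import Data.List.Base as List
  using (List; []; _∷_; map; concat; concatMap; filter; find; foldr; upTo;
         cartesianProduct; cartesianProductWith)
open import Data.List.Relation.Binary.Subset.Propositional using (_⊆_)
open import Data.List.Relation.Unary.All as All using (All; []; _∷_)
open import Data.List.Relation.Unary.AllPairs using (AllPairs; allPairs?)
open import Data.List.Relation.Unary.Any as Any using (Any)
open import Data.Maybe.Base using (Maybe; just; nothing; maybe′)
open import Data.Nat.Base using (ℕ; zero; suc; _∸_; _≤_; _<_; s≤s) renaming (_+_ to _+ℕ_)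
open import Data.Nat.ListAction using (sum)
import Data.Nat.Properties as ℕ
open import Data.Product.Base using (Σ; ∃-syntax; _×_; _,_; proj₁; proj₂)
open import Data.Vec.Base as Vec using (Vec; []; _∷_; _∷ʳ_; tabulate; lookup)
import Data.Vec.Properties as Vec
open import Function.Base using (_∘_)
open import Relation.Binary.Definitions using (DecidableEquality)
open import Relation.Binary.PropositionalEquality.Core using (_≡_)
open import Relation.Nullary.Decidable using (Dec; yes; no; does; _×-dec_; _→-dec_; ¬?; map′)
open import Relation.Nullary.Negation using (¬_)
open import Relation.Unary using (Pred; Decidable)

infix 4 _≟ˢ_

_≟ˢ_ : ∀ {n} → DecidableEquality (Subset n)
_≟ˢ_ = Vec.≡-dec Bool._≟_

⟦_⟧ : ∀ {n p} {P : Pred (Fin n) p} → Decidable P → Subset n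
⟦ P? ⟧ = tabulate (does ∘ P?)

⋃[_] : ∀ {m n} → Subset m → (Fin m → Subset n) → Subset n
⋃[ S ] f = ⟦ (λ i → Fin.any? (λ j → (j ∈? S) ×-dec (i ∈? f j))) ⟧

-- The number k ∈ {1,…,n} is represented by the element of Fin n whose toℕ is
-- k - 1; so this is {p+1,…,p+q}.
interval : ∀ {n} → ℕ → ℕ → Subset n
interval p q = ⟦ (λ i → (p ℕ.≤? toℕ i) ×-dec (toℕ i ℕ.<? p +ℕ q)) ⟧

------------------------------------------------------------------------
-- Set partitions

-- For disjoint nonempty B and C this says min B < min C.
_≺_ : ∀ {n} → Subset n → Subset n → Set
B ≺ C = ∃[ i ] (i ∈ B × (∀ j → j ∈ C → i Fin.< j))

_≺?_ : ∀ {n} (B C : Subset n) → Dec (B ≺ C)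
B ≺? C = Fin.any? λ i → (i ∈? B) ×-dec Fin.all? λ j → (j ∈? C) →-dec (i Fin.<? j)

IsPartition : ∀ {n} → List (Subset n) → Set
IsPartition Bs = All Nonempty Bs
               × AllPairs (λ B C → Empty (B ∩ C)) Bs
               × (∀ i → Any (i ∈_) Bs)
               × AllPairs _≺_ Bs

isPartition? : ∀ {n} (Bs : List (Subset n)) → Dec (IsPartition Bs)
isPartition? Bs = All.all? nonempty? Bs
            ×-dec allPairs? (λ B C → ¬? (nonempty? (B ∩ C))) Bs
            ×-dec Fin.all? (λ i → Any.any? (i ∈?_) Bs)
            ×-dec allPairs? _≺?_ Bs

-- Listing the blocks by increasing minimum gives each set partition exactly one
-- representative, so _≡_ on this type is equality of set partitions.
record Partition (n : ℕ) : Set where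
  constructor partition
  field
    blocks       : List (Subset n)
    .isPartition : IsPartition blocks

open Partition public

_≐_ : ∀ {n} → List (Subset n) → List (Subset n) → Set
Bs ≐ Cs = Bs ⊆ Cs × Cs ⊆ Bs

_≐?_ : ∀ {n} (Bs Cs : List (Subset n)) → Dec (Bs ≐ Cs)
Bs ≐? Cs = (Bs ⊆? Cs) ×-dec (Cs ⊆? Bs)
  where open import Data.List.Relation.Binary.Subset.DecPropositional _≟ˢ_ using (_⊆?_)

module _ {n : ℕ} (π : Partition n) where

  _∼_ : Fin n → Fin n → Set
  i ∼ j = Any (λ B → i ∈ B × j ∈ B) (blocks π)

  _∼?_ : ∀ i j → Dec (i ∼ j)
  i ∼? j = Any.any? (λ B → (i ∈? B) ×-dec (j ∈? B)) (blocks π)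

  -- T selects the blocks whose union is taken.
  Splits : Subset n → Set
  Splits S = ∃[ T ] S ≡ ⋃[ T ] (List.lookup (blocks π))

  splits? : Decidable Splits
  splits? S = anySubset? λ T → S ≟ˢ ⋃[ T ] (List.lookup (blocks π))

  Connected : Set
  Connected = ∀ p q → p < p +ℕ q → p +ℕ q ≤ n → q < n → ¬ Splits (interval p q)

  NoAdjacent : Set
  NoAdjacent = ∀ i j → toℕ j ≡ suc (toℕ i) → ¬ i ∼ j

  EndsSeparated : Set
  EndsSeparated = ∀ i j → toℕ i ≡ 0 → suc (toℕ j) ≡ n → ¬ i ∼ j

  CO PC⁺ PC NC : Set
  CO  = Connected
  PC⁺ = Connected × NoAdjacent
  PC  = Connected × NoAdjacent × EndsSeparated
  NC  = ∀ i j k l → i Fin.< j → j Fin.< k → k Fin.< l → i ∼ k → j ∼ l → i ∼ j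

module _ {n : ℕ} where

  co? : Decidable (CO {n})
  co? π = map′ (λ h p q p<p+q p+q≤n q<n → h (s≤s (ℕ.≤-trans (ℕ.<⇒≤ p<p+q) p+q≤n)) q<n p<p+q p+q≤n)
               (λ h {p} _ {q} q<n p<p+q p+q≤n → h p q p<p+q p+q≤n q<n)
               (ℕ.allUpTo? (λ p → ℕ.allUpTo? (λ q →
                  (p ℕ.<? p +ℕ q) →-dec (p +ℕ q ℕ.≤? n) →-dec
                  ¬? (splits? π (interval p q))) n) (suc n))

  private
    noAdjacent? : Decidable (NoAdjacent {n})
    noAdjacent? π = Fin.all? λ i → Fin.all? λ j →
      (toℕ j ℕ.≟ suc (toℕ i)) →-dec ¬? (_∼?_ π i j)

    endsSeparated? : Decidable (EndsSeparated {n})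
    endsSeparated? π = Fin.all? λ i → Fin.all? λ j →
      (toℕ i ℕ.≟ 0) →-dec (suc (toℕ j) ℕ.≟ n) →-dec ¬? (_∼?_ π i j)

  pc⁺? : Decidable (PC⁺ {n})
  pc⁺? π = co? π ×-dec noAdjacent? π

  pc? : Decidable (PC {n})
  pc? π = co? π ×-dec noAdjacent? π ×-dec endsSeparated? π

  nc? : Decidable (NC {n})
  nc? π = Fin.all? λ i → Fin.all? λ j → Fin.all? λ k → Fin.all? λ l →
    (i Fin.<? j) →-dec (j Fin.<? k) →-dec (k Fin.<? l) →-dec
    (_∼?_ π i k) →-dec (_∼?_ π j l) →-dec (_∼?_ π i j)

------------------------------------------------------------------------
-- Enumerations without repetition

words : ∀ {A : Set} → List A → (m : ℕ) → List (Vec A m)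
words xs zero    = [] ∷ []
words xs (suc m) = cartesianProductWith _∷_ xs (words xs m)

-- A partition of [n] has at most n blocks, so all of them are found.
partitions : (n : ℕ) → List (Partition n)
partitions n = List.mapMaybe check
  (concatMap (λ k → map Vec.toList (words (words (inside ∷ outside ∷ []) n) k)) (upTo (suc n)))
  where
  check : List (Subset n) → Maybe (Partition n)
  check Bs with isPartition? Bs
  ... | yes p = just (partition Bs p)
  ... | no  _ = nothing

compositions : (n ℓ : ℕ) → List (Vec ℕ ℓ)
compositions n ℓ = filter (λ ks → Vec.sum ks ℕ.≟ n) (words (map suc (upTo n)) ℓ)

choices : ∀ {A : Set} {P : A → Set} → (∀ x → List (P x)) → (xs : List A) → List (All P xs)
choices f []       = [] ∷ []
choices f (x ∷ xs) = cartesianProductWith _∷_ (f x) (choices f xs)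

------------------------------------------------------------------------
-- The constructions σ̃, Φ and Ψ, each given by its set of blocks

tilde : ∀ {m} → Partition (suc m) → List (Subset (suc (suc m)))
tilde σ = map (λ B → B ∷ʳ lookup B zero) (blocks σ)

ΦTuple : Set
ΦTuple = Σ ℕ λ ℓ → Partition ℓ × Vec ℕ ℓ

Φ-tuples : ℕ → List ΦTuple
Φ-tuples n = concatMap
  (λ ℓ → map (ℓ ,_) (cartesianProduct (filter pc⁺? (partitions ℓ)) (compositions n ℓ)))
  (map suc (upTo n))

Φ : (n : ℕ) → ΦTuple → List (Subset n)
Φ n (ℓ , σ , ks) = map (λ S → ⋃[ S ] I) (blocks σ)
  where
  I : Fin ℓ → Subset n
  I j = interval (sum (List.take (toℕ j) (Vec.toList ks))) (lookup ks j)

-- The order-preserving bijection from {1,…,|B|} to B.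
ψ : ∀ {n} (B : Subset n) → Fin ∣ B ∣ → Fin n
ψ (inside  ∷ B) zero    = zero
ψ (inside  ∷ B) (suc k) = suc (ψ B k)
ψ (outside ∷ B) k       = suc (ψ B k)

ψ-blocks : ∀ {n} {B : Subset n} → Partition ∣ B ∣ → List (Subset n)
ψ-blocks {B = B} σ = map (λ S → ⋃[ S ] (λ k → ⁅ ψ B k ⁆)) (blocks σ)

ΨTuple : ℕ → Set
ΨTuple n = Σ (Partition n) λ τ → All (λ B → Partition ∣ B ∣) (blocks τ)

Ψ-tuples : (n : ℕ) → List (ΨTuple n)
Ψ-tuples n = concatMap
  (λ τ → map (τ ,_) (choices (λ B → filter co? (partitions ∣ B ∣)) (blocks τ)))
  (filter nc? (partitions n))

Ψ : ∀ {n} → ΨTuple n → List (Subset n)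
Ψ (τ , σs) = concat (All.reduce (λ {B} σ → ψ-blocks {B = B} σ) σs)

------------------------------------------------------------------------
-- Weights and their generating functions

-- Only the values of a on PC matter.
module Weights {r ℓ} (R : CommutativeRing r ℓ)
               (a : ∀ {n} → Partition n → CommutativeRing.Carrier R) where

  open CommutativeRing R

  ∑-over ∏-over : List Carrier → Carrier
  ∑-over = foldr _+_ 0#
  ∏-over = foldr _*_ 1#

  -- In b, c and d the searched list contains exactly one match whenever the
  -- argument lies in PC⁺ (but not in PC), CO or P respectively.  On other
  -- arguments, and for n = 0, the values are junk and never used.

  b : ∀ {n} → Partition n → Carrier
  b {zero}        π = 0#
  b {suc zero}    π = 1#
  b {suc (suc m)} π =
    if does (pc? π) then a π
    else maybe′ a 0# (find (λ σ → tilde σ ≐? blocks π) (filter pc? (partitions (suc m))))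

  c : ∀ {n} → Partition n → Carrier
  c {n} π = maybe′ (λ t → b (proj₁ (proj₂ t))) 0#
                   (find (λ t → Φ n t ≐? blocks π) (Φ-tuples n))

  d : ∀ {n} → Partition n → Carrier
  d {n} π = maybe′ (λ t → ∏-over (All.reduce c (proj₂ t))) 0#
                   (find (λ t → Ψ t ≐? blocks π) (Ψ-tuples n))

  C D : ℕ → Carrier
  C zero      = 0#
  C n@(suc _) = ∑-over (map c (filter co? (partitions n)))
  D zero      = 1#
  D n@(suc _) = ∑-over (map d (partitions n))

------------------------------------------------------------------------
-- Formal power series, as sequences of coefficients

module PowerSeries {r ℓ} (R : CommutativeRing r ℓ) where

  open CommutativeRing R
  open import Algebra.Properties.Monoid.Sum +-monoid using (sum-syntax)

  Series : Set r
  Series = ℕ → Carrier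

  infix  4 _≋_
  infixl 6 _⊕_ _⊝_
  infixl 7 _⊛_ _⊘_
  infixr 8 _^_
  infixr 9 _⟨_⟩

  _≋_ : Series → Series → Set ℓ
  f ≋ g = ∀ n → f n ≈ g n

  𝟙 X : Series
  𝟙 zero    = 1#
  𝟙 (suc n) = 0#
  X zero          = 0#
  X (suc zero)    = 1#
  X (suc (suc n)) = 0#

  _⊕_ _⊝_ _⊛_ : Series → Series → Series
  (f ⊕ g) n = f n + g n
  (f ⊝ g) n = f n - g n
  (f ⊛ g) n = ∑[ i < suc n ] (f (toℕ i) * g (n ∸ toℕ i))

  _^_ : Series → ℕ → Series
  f ^ zero  = 𝟙
  f ^ suc k = f ⊛ f ^ k

  -- f(g(x)), for g with zero constant term: then gᵏ does not contribute to the
  -- coefficient of xⁿ if k > n.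
  _⟨_⟩ : Series → Series → Series
  (f ⟨ g ⟩) n = ∑[ k < suc n ] (f (toℕ k) * (g ^ toℕ k) n)

  -- f / g, for g with constant term 1: 1/g is the geometric series Σₖ (1 - g)ᵏ,
  -- in which the terms with k > n do not contribute to the coefficient of xⁿ.
  _⊘_ : Series → Series → Series
  f ⊘ g = f ⊛ λ n → ∑[ k < suc n ] (((𝟙 ⊝ g) ^ toℕ k) n)

  record IsCompositionalInverse (f g : Series) : Set ℓ where
    field
      constant : g 0 ≈ 0#
      inverseˡ : g ⟨ f ⟩ ≋ X
      inverseʳ : f ⟨ g ⟩ ≋ X

{-# OPTIONS --safe #-}
module Submission where

-- Ψ is injective on the tuples with τ noncrossing and all σⱼ connected: a noncrossing equivalence
-- relation on [m] that contains a connected partition is total, since otherwise a gap in the class of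
-- its least element would be a proper splitting interval. Hence τ is the finest noncrossing partition
-- coarser than Ψ(τ, σ₁, …), and the σⱼ are the restrictions to its blocks. As d vanishes on partitions
-- that are not of the form Ψ(…), this already gives dₙ = Σ_τ Π_B c_|B| over τ ∈ NC(n) and blocks B of τ.
--
-- Removing the least element of τ ∈ NC(n + 1) leaves a noncrossing partition of the gap before the next
-- element of its block and one of the remaining elements. If f weighs the size of the block of the least
-- element, this gives W_f = f₀ + x D W_{f′} with f = f₀ + x f′, the recursion that f(xD) satisfies; so
-- W_f = f(xD), and f = 1 + C gives the equation for D. It says that w/(1 + C(w)) is a left inverse of
-- F = xD, and composition with F is injective because F has no constant term and linear coefficient 1.

open import Defs
open import Algebra.Bundles using (CommutativeRing)
open import Data.Fin.Base as Fin using (Fin; zero; suc; toℕ; fromℕ<; _↑ˡ_; _↑ʳ_)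
open import Data.Fin.Subset using (Subset; inside; outside; ∣_∣; Nonempty) renaming (⊥ to ∅)
open import Data.Fin.Subset.Properties using (∣⊥∣≡0)
open import Data.List.Base as List using (List; []; _∷_; allFin; concat; concatMap; filter; foldr;
  map; cartesianProduct; cartesianProductWith)
import Data.List.Properties as List
open import Data.List.Membership.Propositional using () renaming (_∈_ to _∈ˡ_)
open import Data.List.Relation.Binary.Permutation.Propositional as Perm using (_↭_; prep)
open import Data.List.Relation.Unary.All as All using (All; []; _∷_)
open import Data.List.Relation.Unary.AllPairs using ([]; _∷_)
open import Data.List.Relation.Unary.Any as Any using (Any; here; there)
open import Data.List.Relation.Unary.Unique.Propositional using (Unique)
open import Data.Maybe.Base using (Maybe; just; nothing; maybe′)
open import Data.Nat.Base using (ℕ; zero; suc; _∸_; _≤_; _<_; z≤n; s≤s)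
import Data.Nat.Properties as ℕ
open import Data.Product.Base using (Σ; ∃; _×_; _,_; proj₁; proj₂)
open import Data.Vec.Base as Vec using ([]; _∷_)
open import Function.Base using (_∘_)
import Relation.Binary.PropositionalEquality as ≡
open import Relation.Binary.PropositionalEquality.Core using (_≡_; _≢_)
open import Relation.Nullary
open import Relation.Nullary.Decidable using (dec-true; dec-false)
open import Relation.Unary using (Decidable)

-- Formal power series

-- The weight `f` must stay arbitrary: taking the least element out of its block lowers the size of
-- that block by one, so `f` turns into its shift, and no statement about 1 + C alone would be
-- inductive. On the side of series the matching recursion is Horner's rule, f(h) = f₀ + h f′(h). It
-- is not definitional, because `_⟨_⟩` cuts its sum at a bound that depends on the coefficient, so
-- truncations of different lengths have to be compared first. When h has no constant term, the
-- coefficient of xⁿ in h g involves g only below degree n; this drives all inductions on the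
-- degree. On the combinatorial side `d` is defined by a search through a list of tuples. Its sum
-- can be exchanged for a sum over tuples once no two listed tuples match the same partition, which
-- is why injectivity of Ψ is the central point. Reindexings reduce to repetition-free lists with
-- the same members.

module SeriesProperties {r ℓ} (R : CommutativeRing r ℓ) where

  open CommutativeRing R hiding (zero)
  open PowerSeries R
  open import Algebra.Properties.Monoid.Sum +-monoid using (sum; sum-cong-≋; sum-replicate-zero)
  open import Algebra.Properties.CommutativeMonoid.Sum +-commutativeMonoid using (∑-distrib-+)
  open import Algebra.Properties.Semiring.Sum semiring using (*-distribˡ-sum)
  open import Algebra.Properties.CommutativeSemigroup +-commutativeSemigroup
    using () renaming (interchange to +-interchange; x∙yz≈y∙xz to +-left-swap)
  open import Algebra.Properties.CommutativeSemigroup *-commutativeSemigroup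
    using () renaming (x∙yz≈y∙xz to *-left-swap)
  open import Relation.Binary.Reasoning.Setoid setoid

  infixl 7 _·_

  tail : Series → Series
  tail f n = f (suc n)

  _·_ : Carrier → Series → Series
  (x · f) n = x * f n

  ≋-refl : ∀ {f} → f ≋ f
  ≋-refl n = refl

  ≋-sym : ∀ {f g} → f ≋ g → g ≋ f
  ≋-sym e n = sym (e n)

  ≋-trans : ∀ {f g h} → f ≋ g → g ≋ h → f ≋ h
  ≋-trans e e′ n = trans (e n) (e′ n)

  ⊕-cong : ∀ {f f′ g g′} → f ≋ f′ → g ≋ g′ → f ⊕ g ≋ f′ ⊕ g′
  ⊕-cong e e′ n = +-cong (e n) (e′ n)

  -- The bound on the indices lets an induction hypothesis that is known only in low degrees be
  -- applied under a product.
  ⊛-cong-≤ : ∀ n {f f′ g g′} → (∀ i → i ≤ n → f i ≈ f′ i) → (∀ i → i ≤ n → g i ≈ g′ i) →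
             (f ⊛ g) n ≈ (f′ ⊛ g′) n
  ⊛-cong-≤ zero e e′ = +-congʳ (*-cong (e 0 z≤n) (e′ 0 z≤n))
  ⊛-cong-≤ (suc n) {f} {f′} {g} {g′} e e′ = +-cong (*-cong (e 0 z≤n) (e′ (suc n) ℕ.≤-refl))
    (⊛-cong-≤ n {tail f} {tail f′} {g} {g′} (λ i i≤n → e (suc i) (s≤s i≤n)) (λ i i≤n → e′ i (ℕ.m≤n⇒m≤1+n i≤n)))

  ⊛-cong : ∀ {f f′ g g′} → f ≋ f′ → g ≋ g′ → f ⊛ g ≋ f′ ⊛ g′
  ⊛-cong {f} {f′} {g} {g′} e e′ n = ⊛-cong-≤ n {f} {f′} {g} {g′} (λ i _ → e i) (λ i _ → e′ i)

  ⊛-congˡ : ∀ f {g g′} → g ≋ g′ → f ⊛ g ≋ f ⊛ g′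
  ⊛-congˡ f {g} {g′} e = ⊛-cong {f} {f} {g} {g′} (λ _ → refl) e

  ⊛-congʳ : ∀ g {f f′} → f ≋ f′ → f ⊛ g ≋ f′ ⊛ g
  ⊛-congʳ g {f} {f′} e = ⊛-cong {f} {f′} {g} {g} e (λ _ → refl)

  ⊛-zero : ∀ f g → (f ⊛ g) 0 ≈ f 0 * g 0
  ⊛-zero f g = +-identityʳ _

  -- The recursion (f ⊛ g) (suc n) = f 0 * g (suc n) + (tail f ⊛ g) n holds
  -- definitionally; this is its mirror image.
  ⊛-sucʳ : ∀ n f g → (f ⊛ g) (suc n) ≈ f (suc n) * g 0 + (f ⊛ tail g) n
  ⊛-sucʳ zero f g = +-left-swap _ _ _
  ⊛-sucʳ (suc n) f g = begin
    f 0 * g (2 +ℕ n) + (tail f ⊛ g) (suc n)                        ≈⟨ +-congˡ (⊛-sucʳ n (tail f) g) ⟩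
    f 0 * g (2 +ℕ n) + (f (2 +ℕ n) * g 0 + (tail f ⊛ tail g) n)    ≈⟨ +-left-swap _ _ _ ⟩
    f (2 +ℕ n) * g 0 + (f 0 * g (2 +ℕ n) + (tail f ⊛ tail g) n)    ∎
    where open import Data.Nat.Base using () renaming (_+_ to _+ℕ_)

  ⊛-comm : ∀ f g → f ⊛ g ≋ g ⊛ f
  ⊛-comm f g zero    = +-congʳ (*-comm _ _)
  ⊛-comm f g (suc n) = begin
    f 0 * g (suc n) + (tail f ⊛ g) n ≈⟨ +-cong (*-comm _ _) (⊛-comm (tail f) g n) ⟩
    g (suc n) * f 0 + (g ⊛ tail f) n ≈⟨ ⊛-sucʳ n g f ⟨
    (g ⊛ f) (suc n)                  ∎

  ⊛-distribʳ : ∀ h f g → (f ⊕ g) ⊛ h ≋ f ⊛ h ⊕ g ⊛ h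
  ⊛-distribʳ h f g zero    = trans (+-congʳ (distribʳ _ _ _))
    (trans (+-congˡ (sym (+-identityˡ 0#))) (+-interchange _ _ _ _))
  ⊛-distribʳ h f g (suc n) =
    trans (+-cong (distribʳ _ _ _) (⊛-distribʳ h (tail f) (tail g) n)) (+-interchange _ _ _ _)

  ·-⊛ : ∀ x f g → (x · f) ⊛ g ≋ x · (f ⊛ g)
  ·-⊛ x f g zero    = trans (+-cong (*-assoc _ _ _) (sym (zeroʳ x))) (sym (distribˡ _ _ _))
  ·-⊛ x f g (suc n) = trans (+-cong (*-assoc _ _ _) (·-⊛ x (tail f) g n)) (sym (distribˡ _ _ _))

  ⊛-assoc : ∀ f g h → (f ⊛ g) ⊛ h ≋ f ⊛ (g ⊛ h)
  ⊛-assoc f g h zero = begin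
    (f ⊛ g) 0 * h 0 + 0#   ≈⟨ +-congʳ (*-congʳ (⊛-zero f g)) ⟩
    f 0 * g 0 * h 0 + 0#   ≈⟨ +-congʳ (*-assoc _ _ _) ⟩
    f 0 * (g 0 * h 0) + 0# ≈⟨ +-congʳ (*-congˡ (⊛-zero g h)) ⟨
    f 0 * (g ⊛ h) 0 + 0#   ∎
  ⊛-assoc f g h (suc n) = begin
    (f ⊛ g) 0 * h (suc n) + ((f 0 · tail g ⊕ tail f ⊛ g) ⊛ h) n
      ≈⟨ +-cong (trans (*-congʳ (⊛-zero f g)) (*-assoc _ _ _)) (⊛-distribʳ h (f 0 · tail g) (tail f ⊛ g) n) ⟩
    f 0 * (g 0 * h (suc n)) + (((f 0 · tail g) ⊛ h) n + ((tail f ⊛ g) ⊛ h) n)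
      ≈⟨ +-congˡ (+-cong (·-⊛ (f 0) (tail g) h n) (⊛-assoc (tail f) g h n)) ⟩
    f 0 * (g 0 * h (suc n)) + (f 0 * (tail g ⊛ h) n + (tail f ⊛ (g ⊛ h)) n)
      ≈⟨ +-assoc _ _ _ ⟨
    f 0 * (g 0 * h (suc n)) + f 0 * (tail g ⊛ h) n + (tail f ⊛ (g ⊛ h)) n
      ≈⟨ +-congʳ (distribˡ _ _ _) ⟨
    f 0 * (g ⊛ h) (suc n) + (tail f ⊛ (g ⊛ h)) n ∎

  0⊛ : ∀ f → (λ _ → 0#) ⊛ f ≋ λ _ → 0#
  0⊛ f zero    = trans (+-identityʳ _) (zeroˡ _)
  0⊛ f (suc n) = trans (+-cong (zeroˡ _) (0⊛ f n)) (+-identityˡ _)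

  ⊛-identityˡ : ∀ f → 𝟙 ⊛ f ≋ f
  ⊛-identityˡ f zero    = trans (+-identityʳ _) (*-identityˡ _)
  ⊛-identityˡ f (suc n) = trans (+-cong (*-identityˡ _) (0⊛ f n)) (+-identityʳ _)

  ⊛-identityʳ : ∀ f → f ⊛ 𝟙 ≋ f
  ⊛-identityʳ f = ≋-trans (⊛-comm f 𝟙) (⊛-identityˡ f)

  ⊛-distribˡ : ∀ h f g → h ⊛ (f ⊕ g) ≋ h ⊛ f ⊕ h ⊛ g
  ⊛-distribˡ h f g = ≋-trans (⊛-comm h (f ⊕ g))
    (≋-trans (⊛-distribʳ h f g) (⊕-cong (⊛-comm f h) (⊛-comm g h)))

  ⊛-· : ∀ x f g → f ⊛ (x · g) ≋ x · (f ⊛ g)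
  ⊛-· x f g n = trans (⊛-comm f (x · g) n) (trans (·-⊛ x g f n) (*-congˡ (⊛-comm g f n)))

  tail-X : tail X ≋ 𝟙
  tail-X zero    = refl
  tail-X (suc n) = refl

  0≈⇒⊛-suc : ∀ h → h 0 ≈ 0# → ∀ f n → (h ⊛ f) (suc n) ≈ (tail h ⊛ f) n
  0≈⇒⊛-suc h h0 f n = trans (+-congʳ (trans (*-congʳ h0) (zeroˡ _))) (+-identityˡ _)

  0≈⇒⊛-zero : ∀ h → h 0 ≈ 0# → ∀ f → (h ⊛ f) 0 ≈ 0#
  0≈⇒⊛-zero h h0 f = trans (+-identityʳ _) (trans (*-congʳ h0) (zeroˡ _))

  -- A factor without constant term raises the degree, so the strict bound `i < n` suffices.
  -- Recursions through such a factor are therefore well-founded in the degree.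
  0≈⇒⊛-cong-< : ∀ h → h 0 ≈ 0# → ∀ n {f g} → (∀ i → i < n → f i ≈ g i) → (h ⊛ f) n ≈ (h ⊛ g) n
  0≈⇒⊛-cong-< h h0 zero {f} {g} e = trans (0≈⇒⊛-zero h h0 f) (sym (0≈⇒⊛-zero h h0 g))
  0≈⇒⊛-cong-< h h0 (suc n) {f} {g} e = trans (0≈⇒⊛-suc h h0 f n)
    (trans (⊛-cong-≤ n {tail h} {tail h} {f} {g} (λ _ _ → refl) (λ i i≤n → e i (s≤s i≤n)))
           (sym (0≈⇒⊛-suc h h0 g n)))

  X⊛-suc : ∀ f n → (X ⊛ f) (suc n) ≈ f n
  X⊛-suc f n = trans (0≈⇒⊛-suc X refl f n) (trans (⊛-congʳ f tail-X n) (⊛-identityˡ f n))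

  X⊛-zero : ∀ f → (X ⊛ f) 0 ≈ 0#
  X⊛-zero = 0≈⇒⊛-zero X refl

  -- Composition with a series without constant term

  module _ (h : Series) (h0 : h 0 ≈ 0#) where

    private
      truncated : ℕ → Series → Series
      truncated m f n = sum {m} (λ k → f (toℕ k) * (h ^ toℕ k) n)

      ⊛-sum : ∀ m (s : Fin m → Series) → h ⊛ (λ n → sum (λ k → s k n)) ≋ λ n → sum (λ k → (h ⊛ s k) n)
      ⊛-sum zero    s n = trans (⊛-comm h (λ _ → 0#) n) (0⊛ h n)
      ⊛-sum (suc m) s n = trans (⊛-distribˡ h (s zero) (λ n → sum (λ k → s (suc k) n)) n) (+-congˡ (⊛-sum m (s ∘ suc) n))

      truncated-suc : ∀ m f → truncated (suc m) f ≋ f 0 · 𝟙 ⊕ h ⊛ truncated m (tail f)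
      truncated-suc m f n = +-congˡ (sym (trans
        (⊛-sum m (λ k → f (suc (toℕ k)) · h ^ toℕ k) n)
        (sum-cong-≋ {m} λ k → ⊛-· (f (suc (toℕ k))) h (h ^ toℕ k) n)))

      -- Each Horner step removes one term from both truncations and, through the factor `h`, lowers
      -- the degree, so both bounds stay above it. The induction has to vary `f`, which is replaced
      -- by its tail.
      truncated-stable : ∀ m m′ f n → n < m → n < m′ → truncated m f n ≈ truncated m′ f n
      truncated-stable (suc m) (suc m′) f n (s≤s n≤m) (s≤s n≤m′) = begin
        truncated (suc m) f n                    ≈⟨ truncated-suc m f n ⟩
        f 0 * 𝟙 n + (h ⊛ truncated m (tail f)) n  ≈⟨ +-congˡ (0≈⇒⊛-cong-< h h0 n λ i i<n →
                                                      truncated-stable m m′ (tail f) i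
                                                        (ℕ.≤-trans i<n n≤m) (ℕ.≤-trans i<n n≤m′)) ⟩
        f 0 * 𝟙 n + (h ⊛ truncated m′ (tail f)) n ≈⟨ truncated-suc m′ f n ⟨
        truncated (suc m′) f n                   ∎

    -- At degree `n` the left side leaves `n` terms for the tail, whereas the composition on the
    -- right uses `suc i` terms at each degree `i < n`; stability of truncations reconciles the two.
    ⟨⟩-horner : ∀ f → f ⟨ h ⟩ ≋ f 0 · 𝟙 ⊕ h ⊛ tail f ⟨ h ⟩
    ⟨⟩-horner f n = trans (truncated-suc n f n) (+-congˡ (0≈⇒⊛-cong-< h h0 n λ i i<n →
      truncated-stable n (suc i) (tail f) i i<n ℕ.≤-refl))

    ⟨⟩-congˡ : ∀ {f g} → f ≋ g → f ⟨ h ⟩ ≋ g ⟨ h ⟩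
    ⟨⟩-congˡ e n = sum-cong-≋ {suc n} λ k → *-congʳ {(h ^ toℕ k) n} (e (toℕ k))

    ⟨⟩-zero : ∀ f → (f ⟨ h ⟩) 0 ≈ f 0
    ⟨⟩-zero f = trans (+-identityʳ _) (*-identityʳ _)

    ⟨⟩-⊕ : ∀ f g → (f ⊕ g) ⟨ h ⟩ ≋ f ⟨ h ⟩ ⊕ g ⟨ h ⟩
    ⟨⟩-⊕ f g n = trans (sum-cong-≋ {suc n} λ k → distribʳ ((h ^ toℕ k) n) (f (toℕ k)) (g (toℕ k)))
      (∑-distrib-+ {suc n} (λ k → f (toℕ k) * (h ^ toℕ k) n) (λ k → g (toℕ k) * (h ^ toℕ k) n))

    ⟨⟩-· : ∀ x f → (x · f) ⟨ h ⟩ ≋ x · f ⟨ h ⟩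
    ⟨⟩-· x f n = trans (sum-cong-≋ {suc n} λ k → *-assoc x (f (toℕ k)) ((h ^ toℕ k) n))
      (sym (*-distribˡ-sum {suc n} x (λ k → f (toℕ k) * (h ^ toℕ k) n)))

    ⟨⟩-constant : ∀ f → tail f ≋ (λ _ → 0#) → f ⟨ h ⟩ ≋ f 0 · 𝟙
    ⟨⟩-constant f e n = trans (+-congˡ (trans
      (sum-cong-≋ {n} λ k → trans (*-congʳ {(h ^ suc (toℕ k)) n} (e (toℕ k))) (zeroˡ ((h ^ suc (toℕ k)) n))) (sum-replicate-zero n)))
      (+-identityʳ _)

    𝟙⟨⟩ : 𝟙 ⟨ h ⟩ ≋ 𝟙
    𝟙⟨⟩ = ≋-trans (⟨⟩-constant 𝟙 (λ _ → refl)) (λ n → *-identityˡ _)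

    X⟨⟩ : X ⟨ h ⟩ ≋ h
    X⟨⟩ n = begin
      (X ⟨ h ⟩) n                           ≈⟨ ⟨⟩-horner X n ⟩
      0# * 𝟙 n + (h ⊛ tail X ⟨ h ⟩) n        ≈⟨ +-cong (zeroˡ _) (⊛-congˡ h (≋-trans (⟨⟩-congˡ tail-X) 𝟙⟨⟩) n) ⟩
      0# + (h ⊛ 𝟙) n                        ≈⟨ +-identityˡ _ ⟩
      (h ⊛ 𝟙) n                             ≈⟨ ⊛-identityʳ h n ⟩
      h n                                   ∎

    -- The tail of `f ⊛ g` is `f 0 · tail g ⊕ tail f ⊛ g`. After a Horner step only its second
    -- summand is again a product under composition, and it stands behind a factor `h`, so the
    -- hypothesis for `tail f` in lower degrees applies.
    ⟨⟩-⊛ : ∀ f g → (f ⊛ g) ⟨ h ⟩ ≋ f ⟨ h ⟩ ⊛ g ⟨ h ⟩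
    ⟨⟩-⊛ f g n = below (suc n) f n ℕ.≤-refl
      where
      -- The bound `m` turns strong induction on the degree `n` into structural recursion.
      below : ∀ m f n → n < m → ((f ⊛ g) ⟨ h ⟩) n ≈ (f ⟨ h ⟩ ⊛ g ⟨ h ⟩) n
      below (suc m) f n (s≤s n≤m) = begin
        ((f ⊛ g) ⟨ h ⟩) n
          ≈⟨ ⟨⟩-horner (f ⊛ g) n ⟩
        (f ⊛ g) 0 * 𝟙 n + (h ⊛ (f 0 · tail g ⊕ tail f ⊛ g) ⟨ h ⟩) n
          ≈⟨ +-cong (trans (*-congʳ (⊛-zero f g)) (*-assoc _ _ _)) (begin
               (h ⊛ (f 0 · tail g ⊕ tail f ⊛ g) ⟨ h ⟩) n
                 ≈⟨ ⊛-congˡ h (⟨⟩-⊕ (f 0 · tail g) (tail f ⊛ g)) n ⟩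
               (h ⊛ ((f 0 · tail g) ⟨ h ⟩ ⊕ (tail f ⊛ g) ⟨ h ⟩)) n
                 ≈⟨ ⊛-distribˡ h ((f 0 · tail g) ⟨ h ⟩) ((tail f ⊛ g) ⟨ h ⟩) n ⟩
               (h ⊛ (f 0 · tail g) ⟨ h ⟩) n + (h ⊛ (tail f ⊛ g) ⟨ h ⟩) n
                 ≈⟨ +-cong (trans (⊛-congˡ h (⟨⟩-· (f 0) (tail g)) n) (⊛-· (f 0) h (tail g ⟨ h ⟩) n))
                           (0≈⇒⊛-cong-< h h0 n λ i i<n → below m (tail f) i (ℕ.≤-trans i<n n≤m)) ⟩
               f 0 * (h ⊛ tail g ⟨ h ⟩) n + (h ⊛ (tail f ⟨ h ⟩ ⊛ g ⟨ h ⟩)) n ∎) ⟩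
        f 0 * (g 0 * 𝟙 n) + (f 0 * (h ⊛ tail g ⟨ h ⟩) n + (h ⊛ (tail f ⟨ h ⟩ ⊛ g ⟨ h ⟩)) n)
          ≈⟨ +-assoc _ _ _ ⟨
        f 0 * (g 0 * 𝟙 n) + f 0 * (h ⊛ tail g ⟨ h ⟩) n + (h ⊛ (tail f ⟨ h ⟩ ⊛ g ⟨ h ⟩)) n
          ≈⟨ +-cong (sym (distribˡ _ _ _)) (sym (⊛-assoc h (tail f ⟨ h ⟩) (g ⟨ h ⟩) n)) ⟩
        f 0 * (g 0 · 𝟙 ⊕ h ⊛ tail g ⟨ h ⟩) n + (h ⊛ tail f ⟨ h ⟩ ⊛ g ⟨ h ⟩) n
          ≈⟨ +-congʳ (*-congˡ (⟨⟩-horner g n)) ⟨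
        f 0 * (g ⟨ h ⟩) n + (h ⊛ tail f ⟨ h ⟩ ⊛ g ⟨ h ⟩) n
          ≈⟨ +-congʳ (trans (·-⊛ (f 0) 𝟙 (g ⟨ h ⟩) n) (*-congˡ (⊛-identityˡ (g ⟨ h ⟩) n))) ⟨
        ((f 0 · 𝟙) ⊛ g ⟨ h ⟩) n + (h ⊛ tail f ⟨ h ⟩ ⊛ g ⟨ h ⟩) n
          ≈⟨ ⊛-distribʳ (g ⟨ h ⟩) (f 0 · 𝟙) (h ⊛ tail f ⟨ h ⟩) n ⟨
        ((f 0 · 𝟙 ⊕ h ⊛ tail f ⟨ h ⟩) ⊛ g ⟨ h ⟩) n
          ≈⟨ ⊛-congʳ (g ⟨ h ⟩) (⟨⟩-horner f) n ⟨
        (f ⟨ h ⟩ ⊛ g ⟨ h ⟩) n ∎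

  ⟨⟩-congʳ : ∀ f {g h} → g ≋ h → f ⟨ g ⟩ ≋ f ⟨ h ⟩
  ⟨⟩-congʳ f {g} {h} e n = sum-cong-≋ {suc n} λ k → *-congˡ {f (toℕ k)} (^-cong (toℕ k) n)
    where
    ^-cong : ∀ k → g ^ k ≋ h ^ k
    ^-cong zero    = ≋-refl
    ^-cong (suc k) = ⊛-cong {g} {h} {g ^ k} {h ^ k} e (^-cong k)

  ⟨X⟩ : ∀ f → f ⟨ X ⟩ ≋ f
  ⟨X⟩ f zero    = ⟨⟩-zero X refl f
  ⟨X⟩ f (suc n) = begin
    (f ⟨ X ⟩) (suc n)                        ≈⟨ ⟨⟩-horner X refl f (suc n) ⟩
    f 0 * 0# + (X ⊛ tail f ⟨ X ⟩) (suc n)    ≈⟨ +-cong (zeroʳ _) (X⊛-suc (tail f ⟨ X ⟩) n) ⟩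
    0# + (tail f ⟨ X ⟩) n                    ≈⟨ +-identityˡ _ ⟩
    (tail f ⟨ X ⟩) n                         ≈⟨ ⟨X⟩ (tail f) n ⟩
    f (suc n)                                ∎

  -- Horner's rule for `f ⟨ g ⟩`, composed with `h`, becomes Horner's rule for `g ⟨ h ⟩`, because
  -- composition with `h` is additive and multiplicative.
  ⟨⟩-assoc : ∀ f g h → g 0 ≈ 0# → h 0 ≈ 0# → f ⟨ g ⟩ ⟨ h ⟩ ≋ f ⟨ g ⟨ h ⟩ ⟩
  ⟨⟩-assoc f g h g0 h0 n = below (suc n) f n ℕ.≤-refl
    where
    gh0 : (g ⟨ h ⟩) 0 ≈ 0#
    gh0 = trans (⟨⟩-zero h h0 g) g0

    below : ∀ m f n → n < m → (f ⟨ g ⟩ ⟨ h ⟩) n ≈ (f ⟨ g ⟨ h ⟩ ⟩) n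
    below (suc m) f n (s≤s n≤m) = begin
      (f ⟨ g ⟩ ⟨ h ⟩) n
        ≈⟨ ⟨⟩-congˡ h h0 (⟨⟩-horner g g0 f) n ⟩
      ((f 0 · 𝟙 ⊕ g ⊛ tail f ⟨ g ⟩) ⟨ h ⟩) n
        ≈⟨ ⟨⟩-⊕ h h0 (f 0 · 𝟙) (g ⊛ tail f ⟨ g ⟩) n ⟩
      ((f 0 · 𝟙) ⟨ h ⟩) n + ((g ⊛ tail f ⟨ g ⟩) ⟨ h ⟩) n
        ≈⟨ +-cong (trans (⟨⟩-· h h0 (f 0) 𝟙 n) (*-congˡ (𝟙⟨⟩ h h0 n)))
                  (trans (⟨⟩-⊛ h h0 g (tail f ⟨ g ⟩) n)
                         (0≈⇒⊛-cong-< (g ⟨ h ⟩) gh0 n λ i i<n → below m (tail f) i (ℕ.≤-trans i<n n≤m))) ⟩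
      f 0 * 𝟙 n + (g ⟨ h ⟩ ⊛ tail f ⟨ g ⟨ h ⟩ ⟩) n
        ≈⟨ ⟨⟩-horner (g ⟨ h ⟩) gh0 f n ⟨
      (f ⟨ g ⟨ h ⟩ ⟩) n ∎

  -- Reciprocals and cancellation

  reciprocal : Series → Series
  reciprocal g n = sum {suc n} (λ k → ((𝟙 ⊝ g) ^ toℕ k) n)

  -- With u = 1 - g the geometric series H is the all-ones series composed with u, so Horner's rule
  -- gives H = 1 + u H. The calculation adds and subtracts u H, using g + u = 1.
  ⊛-reciprocal : ∀ g → g 0 ≈ 1# → g ⊛ reciprocal g ≋ 𝟙
  ⊛-reciprocal g g0 n = begin
    (g ⊛ reciprocal g) n                                           ≈⟨ +-identityʳ _ ⟨
    (g ⊛ reciprocal g) n + 0#                                      ≈⟨ +-congˡ (-‿inverseʳ _) ⟨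
    (g ⊛ H) n + ((u ⊛ H) n - (u ⊛ H) n)                            ≈⟨ +-assoc _ _ _ ⟨
    (g ⊛ H) n + (u ⊛ H) n - (u ⊛ H) n                              ≈⟨ +-congʳ (⊛-distribʳ H g u n) ⟨
    ((g ⊕ u) ⊛ H) n - (u ⊛ H) n                                    ≈⟨ +-congʳ (⊛-congʳ H g⊕u n) ⟩
    (𝟙 ⊛ H) n - (u ⊛ H) n                                          ≈⟨ +-congʳ (trans (⊛-identityˡ H n) (H-rec n)) ⟩
    𝟙 n + (u ⊛ H) n - (u ⊛ H) n                                    ≈⟨ +-assoc _ _ _ ⟩
    𝟙 n + ((u ⊛ H) n - (u ⊛ H) n)                                  ≈⟨ +-congˡ (-‿inverseʳ _) ⟩
    𝟙 n + 0#                                                       ≈⟨ +-identityʳ _ ⟩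
    𝟙 n                                                            ∎
    where
    u = 𝟙 ⊝ g
    H = reciprocal g
    ones : Series
    ones _ = 1#

    u0 : u 0 ≈ 0#
    u0 = trans (+-congˡ (-‿cong g0)) (-‿inverseʳ 1#)

    g⊕u : g ⊕ u ≋ 𝟙
    g⊕u n = trans (+-comm _ _) (trans (+-assoc _ _ _) (trans (+-congˡ (-‿inverseˡ _)) (+-identityʳ _)))

    H≋ : H ≋ ones ⟨ u ⟩
    H≋ n = sum-cong-≋ {suc n} λ k → sym (*-identityˡ ((u ^ toℕ k) n))

    H-rec : H ≋ 𝟙 ⊕ u ⊛ H
    H-rec n = trans (H≋ n) (trans (⟨⟩-horner u u0 ones n)
      (+-cong (*-identityˡ _) (⊛-congˡ u (≋-sym H≋) n)))

  ⊛-cancelˡ : ∀ h {f g} → h 0 ≈ 1# → h ⊛ f ≋ h ⊛ g → f ≋ g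
  ⊛-cancelˡ h {f} {g} h0 e = ≋-trans (≋-sym (undo f)) (≋-trans (⊛-congˡ (reciprocal h) e) (undo g))
    where
    undo : ∀ f → reciprocal h ⊛ (h ⊛ f) ≋ f
    undo f = ≋-trans (≋-sym (⊛-assoc (reciprocal h) h f))
      (≋-trans (⊛-congʳ f (≋-trans (⊛-comm (reciprocal h) h) (⊛-reciprocal h h0))) (⊛-identityˡ f))

  -- Constant terms agree by evaluation at degree 0. Subtracting them leaves h f′(h) = h g′(h); here
  -- h is x times the invertible series `tail h`, so both factors cancel and the argument repeats
  -- for the tails.
  ⟨⟩-cancelʳ : ∀ h {f g} → h 0 ≈ 0# → h 1 ≈ 1# → f ⟨ h ⟩ ≋ g ⟨ h ⟩ → f ≋ g
  ⟨⟩-cancelʳ h {f} {g} h0 h1 e = go f g e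
    where
    open import Algebra.Properties.Ring ring using (+-cancelˡ)
    f0≈g0 : ∀ f g → f ⟨ h ⟩ ≋ g ⟨ h ⟩ → f 0 ≈ g 0
    f0≈g0 f g e = trans (sym (⟨⟩-zero h h0 f)) (trans (e 0) (⟨⟩-zero h h0 g))
    go : ∀ f g → f ⟨ h ⟩ ≋ g ⟨ h ⟩ → f ≋ g
    go f g e zero = f0≈g0 f g e
    go f g e (suc n) = go (tail f) (tail g) (⊛-cancelˡ (tail h) h1 λ n → begin
      (tail h ⊛ tail f ⟨ h ⟩) n      ≈⟨ 0≈⇒⊛-suc h h0 (tail f ⟨ h ⟩) n ⟨
      (h ⊛ tail f ⟨ h ⟩) (suc n)     ≈⟨ +-cancelˡ (f 0 * 𝟙 (suc n)) _ _ (begin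
         f 0 * 0# + (h ⊛ tail f ⟨ h ⟩) (suc n) ≈⟨ ⟨⟩-horner h h0 f (suc n) ⟨
         (f ⟨ h ⟩) (suc n)                     ≈⟨ e (suc n) ⟩
         (g ⟨ h ⟩) (suc n)                     ≈⟨ ⟨⟩-horner h h0 g (suc n) ⟩
         g 0 * 0# + (h ⊛ tail g ⟨ h ⟩) (suc n) ≈⟨ +-congʳ (*-congʳ (f0≈g0 f g e)) ⟨
         f 0 * 0# + (h ⊛ tail g ⟨ h ⟩) (suc n) ∎) ⟩
      (h ⊛ tail g ⟨ h ⟩) (suc n)     ≈⟨ 0≈⇒⊛-suc h h0 (tail g ⟨ h ⟩) n ⟩
      (tail h ⊛ tail g ⟨ h ⟩) n      ∎) n

  -- The compositional inverse from the functional equation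

  module _ {C D : Series} (C0 : C 0 ≈ 0#) (D-eq : D ≋ 𝟙 ⊕ C ⟨ X ⊛ D ⟩) where

    private
      F G E H : Series
      F = X ⊛ D
      E = 𝟙 ⊕ C
      H = reciprocal E
      G = X ⊘ E

      F0 : F 0 ≈ 0#
      F0 = X⊛-zero D

      E0 : E 0 ≈ 1#
      E0 = trans (+-congˡ C0) (+-identityʳ _)

      D0 : D 0 ≈ 1#
      D0 = trans (D-eq 0) (trans (+-congˡ (trans (⟨⟩-zero F F0 C) C0)) (+-identityʳ _))

      F1 : F 1 ≈ 1#
      F1 = trans (X⊛-suc D 0) D0

      E⟨F⟩ : E ⟨ F ⟩ ≋ D
      E⟨F⟩ = ≋-trans (⟨⟩-⊕ F F0 𝟙 C) (≋-trans (⊕-cong (𝟙⟨⟩ F F0) (λ _ → refl)) (≋-sym D-eq))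

      G0 : G 0 ≈ 0#
      G0 = X⊛-zero H

      -- Since `E ⟨ F ⟩` is `D`, composing the reciprocal `H` of `E` with `F` gives a reciprocal of
      -- `D`, which cancels the factor `D` of `F`.
      G⟨F⟩ : G ⟨ F ⟩ ≋ X
      G⟨F⟩ n = begin
        ((X ⊛ H) ⟨ F ⟩) n          ≈⟨ ⟨⟩-⊛ F F0 X H n ⟩
        (X ⟨ F ⟩ ⊛ H ⟨ F ⟩) n      ≈⟨ ⊛-congʳ (H ⟨ F ⟩) (X⟨⟩ F F0) n ⟩
        (X ⊛ D ⊛ H ⟨ F ⟩) n        ≈⟨ ⊛-assoc X D (H ⟨ F ⟩) n ⟩
        (X ⊛ (D ⊛ H ⟨ F ⟩)) n      ≈⟨ ⊛-congˡ X (⊛-congʳ (H ⟨ F ⟩) E⟨F⟩) n ⟨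
        (X ⊛ (E ⟨ F ⟩ ⊛ H ⟨ F ⟩)) n ≈⟨ ⊛-congˡ X (⟨⟩-⊛ F F0 E H) n ⟨
        (X ⊛ (E ⊛ H) ⟨ F ⟩) n      ≈⟨ ⊛-congˡ X (≋-trans (⟨⟩-congˡ F F0 (⊛-reciprocal E E0)) (𝟙⟨⟩ F F0)) n ⟩
        (X ⊛ 𝟙) n                  ≈⟨ ⊛-identityʳ X n ⟩
        X n                        ∎

      -- The left inverse is also a right one: composed with `F`, both sides become `F` by
      -- associativity, and composition with `F` can be cancelled.
      F⟨G⟩ : F ⟨ G ⟩ ≋ X
      F⟨G⟩ = ⟨⟩-cancelʳ F {F ⟨ G ⟩} {X} F0 F1 λ n → begin
        (F ⟨ G ⟩ ⟨ F ⟩) n ≈⟨ ⟨⟩-assoc F G F G0 F0 n ⟩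
        (F ⟨ G ⟨ F ⟩ ⟩) n ≈⟨ ⟨⟩-congʳ F G⟨F⟩ n ⟩
        (F ⟨ X ⟩) n       ≈⟨ ⟨X⟩ F n ⟩
        F n               ≈⟨ X⟨⟩ F F0 n ⟨
        (X ⟨ F ⟩) n       ∎

    compositionalInverse : IsCompositionalInverse F G
    compositionalInverse = record { constant = G0 ; inverseˡ = G⟨F⟩ ; inverseʳ = F⟨G⟩ }

    compositionalInverse-unique : ∀ G′ → IsCompositionalInverse F G′ → G′ ≋ G
    compositionalInverse-unique G′ inv = ⟨⟩-cancelʳ F {G′} {G} F0 F1
      (≋-trans (IsCompositionalInverse.inverseˡ inv) (≋-sym G⟨F⟩))

module SetPartitions where

  open import Data.Empty using (⊥)
  import Data.Fin.Properties as Fin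
  open import Data.Fin.Subset using (_∈_; _∩_; ⁅_⁆; Empty)
  open import Data.Fin.Subset.Properties
    using (x∈p∩q⁺; x∈p∩q⁻; x∈⁅x⁆; x∈⁅y⁆⇒x≡y; ∉⊥; ⊆-antisym; _∈?_; nonempty?)
  open import Data.List.Membership.Propositional using (find; lose)
  open import Data.List.Membership.Propositional.Properties
  open import Data.List.Membership.Propositional.Properties.WithK using (unique⇒irrelevant; unique∧set⇒bag)
  open import Data.List.Relation.Binary.BagAndSetEquality using (∼bag⇒↭)
  import Data.List.Relation.Unary.All.Properties as All
  open import Data.List.Relation.Unary.AllPairs as AllPairs using (AllPairs)
  import Data.List.Relation.Unary.AllPairs.Properties as AllPairs
  import Data.List.Relation.Unary.Any.Properties as Any
  import Data.List.Relation.Unary.Unique.Propositional.Properties as Unique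
  open import Data.Nat.Base using (_+_)
  open import Data.Product.Base using (swap)
  open import Data.Sum.Base using (inj₁; inj₂)
  open import Data.Unit.Base using (⊤; tt)
  open import Data.Vec.Base using (Vec; here; there; _++_)
  import Data.Vec.Properties as Vec
  open import Function.Base using (id)
  open import Function.Bundles using (mk⇔)
  open import Relation.Binary.Definitions using (tri<; tri≈; tri>)
  open import Relation.Binary.PropositionalEquality
  open import Relation.Binary.Structures using (IsEquivalence)
  open import Relation.Nullary.Decidable using (_×-dec_; _→-dec_; ¬?; decidable-stable)

  private variable
    n : ℕ

  -- Set partitions and their equivalence relations

  All-zip-AllPairs : ∀ {A : Set} {P : A → Set} {R S : A → A → Set} →
    (∀ {x y} → P x → P y → R x y → S x y) →
    ∀ {xs} → All P xs → AllPairs R xs → AllPairs S xs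
  All-zip-AllPairs f []         []         = []
  All-zip-AllPairs f (px ∷ pxs) (rx ∷ rxs) =
    All.zipWith (λ (py , r) → f px py r) (pxs , rx) ∷ All-zip-AllPairs f pxs rxs

  least : ∀ {P : Fin n → Set} → Decidable P → ∃ P → ∃ λ i → P i × (∀ j → P j → i Fin.≤ j)
  least {suc n} P? (i , pi) with P? zero
  ... | yes p0 = zero , p0 , λ _ _ → z≤n
  least {suc n} P? (zero , p0) | no ¬p0 = contradiction p0 ¬p0
  least {suc n} P? (suc i , pi) | no ¬p0 with least (P? ∘ suc) (i , pi)
  ... | k , pk , k≤ = suc k , pk , λ { zero p0 → contradiction p0 ¬p0 ; (suc j) pj → s≤s (k≤ j pj) }

  module _ {P : Fin n → Set} (P? : Decidable P) where

    ∈⟦⟧⁺ : ∀ {i} → P i → i ∈ ⟦ P? ⟧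
    ∈⟦⟧⁺ {i} p = Vec.lookup⇒[]= i _ (trans (Vec.lookup∘tabulate _ i) (dec-true (P? i) p))

    ∈⟦⟧⁻ : ∀ {i} → i ∈ ⟦ P? ⟧ → P i
    ∈⟦⟧⁻ {i} i∈ with P? i | trans (sym (Vec.lookup∘tabulate (does ∘ P?) i)) (Vec.[]=⇒lookup i∈)
    ... | yes p | _ = p
    ... | no _  | ()

  ∈⋃⁺ : ∀ {m} {S : Subset m} {f : Fin m → Subset n} {i j} → j ∈ S → i ∈ f j → i ∈ ⋃[ S ] f
  ∈⋃⁺ {S = S} {f} j∈S i∈fj = ∈⟦⟧⁺ (λ i → Fin.any? (λ j → (j ∈? S) ×-dec (i ∈? f j))) (_ , j∈S , i∈fj)

  ∈⋃⁻ : ∀ {m} {S : Subset m} {f : Fin m → Subset n} {i} → i ∈ ⋃[ S ] f → ∃ λ j → j ∈ S × i ∈ f j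
  ∈⋃⁻ {S = S} {f} = ∈⟦⟧⁻ (λ i → Fin.any? (λ j → (j ∈? S) ×-dec (i ∈? f j)))

  ≺-asym : {B C : Subset n} → B ≺ C → ¬ C ≺ B
  ≺-asym (i , i∈B , i<) (j , j∈C , j<) = ℕ.<-asym (i< j j∈C) (j< i i∈B)

  -- If the heads differed, each would occur in the tail of the other list, giving both B ≺ C and C
  -- ≺ B. Asymmetry also keeps a head out of its own tail, so the tails again have the same members.
  sorted-unique : {Bs Cs : List (Subset n)} → AllPairs _≺_ Bs → AllPairs _≺_ Cs → Bs ≐ Cs → Bs ≡ Cs
  sorted-unique []       []       _ = refl
  sorted-unique []       (_ ∷ _)  (_ , ⊇) with () ← ⊇ (here refl)
  sorted-unique (_ ∷ _)  []       (⊆ , _) with () ← ⊆ (here refl)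
  sorted-unique {Bs = B ∷ Bs} {C ∷ Cs} (B≺ ∷ Bs↗) (C≺ ∷ Cs↗) (⊆ , ⊇) = go B≡C
    where
    B≡C : B ≡ C
    B≡C with ⊆ (here refl) | ⊇ (here refl)
    ... | here e  | _       = e
    ... | there _ | here e  = sym e
    ... | there p | there q = contradiction (All.lookup C≺ p) (≺-asym (All.lookup B≺ q))

    strip : ∀ {x} {xs ys : List (Subset _)} → All (x ≺_) xs → (∀ {z} → z ∈ˡ x ∷ xs → z ∈ˡ x ∷ ys) →
            ∀ {z} → z ∈ˡ xs → z ∈ˡ ys
    strip x≺ sub z∈ with sub (there z∈)
    ... | there z∈ys = z∈ys
    ... | here refl  = contradiction (All.lookup x≺ z∈) (λ x≺x → ≺-asym x≺x x≺x)

    go : B ≡ C → B ∷ Bs ≡ C ∷ Cs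
    go refl = cong (B ∷_) (sorted-unique Bs↗ Cs↗ (strip B≺ ⊆ , strip C≺ ⊇))

  -- The field is irrelevant and cannot be projected for use; decidability recovers its content.
  isPartition′ : (π : Partition n) → IsPartition (blocks π)
  isPartition′ (partition Bs p) = recompute (isPartition? Bs) p

  module _ (π : Partition n) where

    nonempty : ∀ {B} → B ∈ˡ blocks π → Nonempty B
    nonempty = All.lookup (proj₁ (isPartition′ π))

    overlap⇒≡ : ∀ {B C i} → B ∈ˡ blocks π → C ∈ˡ blocks π → i ∈ B → i ∈ C → B ≡ C
    overlap⇒≡ B∈ C∈ i∈B i∈C with ∈-AllPairs₂ (proj₁ (proj₂ (isPartition′ π))) B∈ C∈
    ... | inj₁ B≡C         = B≡C
    ... | inj₂ (inj₁ B∩C) = contradiction (_ , x∈p∩q⁺ (i∈B , i∈C)) B∩C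
    ... | inj₂ (inj₂ C∩B) = contradiction (_ , x∈p∩q⁺ (i∈C , i∈B)) C∩B

    blockOf : ∀ i → ∃ λ B → B ∈ˡ blocks π × i ∈ B
    blockOf i = find (proj₁ (proj₂ (proj₂ (isPartition′ π))) i)

    sorted : AllPairs _≺_ (blocks π)
    sorted = proj₂ (proj₂ (proj₂ (isPartition′ π)))

    blocks-unique : Unique (blocks π)
    blocks-unique = AllPairs.map (λ { B≺C refl → ≺-asym B≺C B≺C }) sorted

    ∈⇒∼ : ∀ {B i j} → B ∈ˡ blocks π → i ∈ B → j ∈ B → _∼_ π i j
    ∈⇒∼ B∈ i∈B j∈B = lose B∈ (i∈B , j∈B)

    ∼⇒∈ : ∀ {B i j} → B ∈ˡ blocks π → i ∈ B → _∼_ π i j → j ∈ B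
    ∼⇒∈ B∈ i∈B i∼j with find i∼j
    ... | C , C∈ , i∈C , j∈C = subst (_ ∈_) (overlap⇒≡ C∈ B∈ i∈C i∈B) j∈C

    ∼-isEquivalence : IsEquivalence (_∼_ π)
    ∼-isEquivalence = record
      { refl  = λ {i} → let B , B∈ , i∈B = blockOf i in ∈⇒∼ B∈ i∈B i∈B
      ; sym   = Any.map swap
      ; trans = λ i∼j j∼k → let B , B∈ , i∈B , j∈B = find i∼j in ∈⇒∼ B∈ i∈B (∼⇒∈ B∈ j∈B j∼k)
      }

    open IsEquivalence ∼-isEquivalence public using () renaming (refl to ∼-refl; sym to ∼-sym; trans to ∼-trans)

  blocks-injective : {π ρ : Partition n} → blocks π ≡ blocks ρ → π ≡ ρ
  blocks-injective refl = refl

  ≐⇒≡ : {π ρ : Partition n} → blocks π ≐ blocks ρ → π ≡ ρ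
  ≐⇒≡ {π = π} {ρ} e = blocks-injective (sorted-unique (sorted π) (sorted ρ) e)

  -- `Cs` is a bare list rather than a `Partition`, so that the lemma can also be applied to block
  -- lists that are not sorted.
  ∼-⊆ : (π : Partition n) {Cs : List (Subset n)} → (∀ {i} → ∃ λ C → C ∈ˡ Cs × i ∈ C) →
        (∀ {C i j} → C ∈ˡ Cs → i ∈ C → j ∈ C → _∼_ π i j) →
        (∀ {C i j} → C ∈ˡ Cs → i ∈ C → _∼_ π i j → j ∈ C) →
        ∀ {B} → B ∈ˡ blocks π → B ∈ˡ Cs
  ∼-⊆ π cover f g B∈ with nonempty π B∈
  ... | i , i∈B with cover {i}
  ... | C , C∈ , i∈C = subst (_∈ˡ _) (⊆-antisym (λ j∈C → ∼⇒∈ π B∈ i∈B (f C∈ i∈C j∈C))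
                                                (λ j∈B → g C∈ i∈C (∈⇒∼ π B∈ i∈B j∈B))) C∈

  ∼-injective : {π ρ : Partition n} → (∀ {i j} → _∼_ π i j → _∼_ ρ i j) → (∀ {i j} → _∼_ ρ i j → _∼_ π i j) → π ≡ ρ
  ∼-injective {π = π} {ρ} f g = ≐⇒≡
    ( ∼-⊆ π (λ {i} → blockOf ρ i) (λ C∈ i∈C j∈C → g (∈⇒∼ ρ C∈ i∈C j∈C)) (λ C∈ i∈C i∼j → ∼⇒∈ ρ C∈ i∈C (f i∼j))
    , ∼-⊆ ρ (λ {i} → blockOf π i) (λ C∈ i∈C j∈C → f (∈⇒∼ π C∈ i∈C j∈C)) (λ C∈ i∈C i∼j → ∼⇒∈ π C∈ i∈C (g i∼j)) )

  module Quotient {R : Fin n → Fin n → Set} (R? : ∀ i j → Dec (R i j)) (equiv : IsEquivalence R) where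

    private module R = IsEquivalence equiv

    -- Each class is represented by its least element. Running through these in increasing order
    -- yields every class once and already sorted by minimum, as `IsPartition` demands.
    Leader : Fin n → Set
    Leader i = ∀ j → R i j → i Fin.≤ j

    leader? : Decidable Leader
    leader? i = Fin.all? λ j → R? i j →-dec (i Fin.≤? j)

    class : Fin n → Subset n
    class i = ⟦ R? i ⟧

    leaders : List (Fin n)
    leaders = filter leader? (allFin n)

    private
      leaders-leader : All Leader leaders
      leaders-leader = All.all-filter leader? (allFin n)

      leaders-↗ : AllPairs Fin._<_ leaders
      leaders-↗ = AllPairs.filter⁺ leader? (AllPairs.tabulate⁺-< id)

      cover : ∀ i → Any (i ∈_) (map class leaders)
      cover i with least (R? i) (i , R.refl)
      ... | k , Rik , k≤ = Any.map⁺ (lose (∈-filter⁺ leader? (∈-allFin k) λ j Rkj → k≤ j (R.trans Rik Rkj))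
                                          (∈⟦⟧⁺ (R? k) (R.sym Rik)))

    quotient : Partition n
    quotient = partition (map class leaders)
      ( All.map⁺ (All.universal {P = Nonempty ∘ class} (λ i → i , ∈⟦⟧⁺ (R? i) R.refl) leaders)
      , AllPairs.map⁺ (All-zip-AllPairs
          (λ _ j-leader i<j (k , k∈) → let k∈i , k∈j = x∈p∩q⁻ _ _ k∈ in
            ℕ.<⇒≱ i<j (j-leader _ (R.trans (∈⟦⟧⁻ (R? _) k∈j) (R.sym (∈⟦⟧⁻ (R? _) k∈i)))))
          leaders-leader leaders-↗)
      , cover
      , AllPairs.map⁺ (All-zip-AllPairs
          (λ {i} {j} _ j-leader i<j → i , ∈⟦⟧⁺ (R? i) R.refl , λ k k∈j → ℕ.<-≤-trans i<j (j-leader k (∈⟦⟧⁻ (R? j) k∈j)))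
          leaders-leader leaders-↗)
      )

    quotient-∼⁺ : ∀ {i j} → R i j → _∼_ quotient i j
    quotient-∼⁺ {i} Rij = Any.map⁺ (Any.map (λ {k} i∈ → i∈ , ∈⟦⟧⁺ (R? k) (R.trans (∈⟦⟧⁻ (R? k) i∈) Rij)) (Any.map⁻ (cover i)))

    quotient-∼⁻ : ∀ {i j} → _∼_ quotient i j → R i j
    quotient-∼⁻ i∼j with find (Any.map⁻ i∼j)
    ... | k , _ , i∈ , j∈ = R.trans (R.sym (∈⟦⟧⁻ (R? k) i∈)) (∈⟦⟧⁻ (R? k) j∈)

  -- Meant for the output of Ψ, which groups its blocks by the blocks of τ and hence need not list
  -- them by minimum. Passing to the equivalence relation and back sorts them and removes
  -- repetitions.
  ≐-partition : (Bs : List (Subset n)) → (∀ {B} → B ∈ˡ Bs → Nonempty B) →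
    (∀ {B C i} → B ∈ˡ Bs → C ∈ˡ Bs → i ∈ B → i ∈ C → B ≡ C) →
    (∀ i → ∃ λ B → B ∈ˡ Bs × i ∈ B) → ∃ λ π → Bs ≐ blocks π
  ≐-partition {n} Bs nonempty overlap⇒≡ cover = quotient , ⊆ , ⊇
    where
    R : Fin n → Fin n → Set
    R i j = Any (λ B → i ∈ B × j ∈ B) Bs

    R? : ∀ i j → Dec (R i j)
    R? i j = Any.any? (λ B → (i ∈? B) ×-dec (j ∈? B)) Bs

    R-isEquivalence : IsEquivalence R
    R-isEquivalence = record
      { refl  = λ {i} → let B , B∈ , i∈B = cover i in lose B∈ (i∈B , i∈B)
      ; sym   = Any.map swap
      ; trans = λ i∼j j∼k → let B , B∈ , i∈B , j∈B = find i∼j ; C , C∈ , j∈C , k∈C = find j∼k in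
                  lose B∈ (i∈B , subst (_ ∈_) (overlap⇒≡ C∈ B∈ j∈C j∈B) k∈C)
      }

    open Quotient R? R-isEquivalence

    R⇒∈ : ∀ {B i j} → B ∈ˡ Bs → i ∈ B → R i j → j ∈ B
    R⇒∈ B∈ i∈B i∼j with find i∼j
    ... | C , C∈ , i∈C , j∈C = subst (_ ∈_) (overlap⇒≡ C∈ B∈ i∈C i∈B) j∈C

    ⊇ : ∀ {B} → B ∈ˡ blocks quotient → B ∈ˡ Bs
    ⊇ = ∼-⊆ quotient (cover _) (λ C∈ i∈C j∈C → quotient-∼⁺ (lose C∈ (i∈C , j∈C)))
                               (λ C∈ i∈C i∼j → R⇒∈ C∈ i∈C (quotient-∼⁻ i∼j))

    ⊆ : ∀ {B} → B ∈ˡ Bs → B ∈ˡ blocks quotient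
    ⊆ B∈ with nonempty B∈
    ... | i , i∈B with blockOf quotient i
    ... | C , C∈ , i∈C = subst (_∈ˡ _) (overlap⇒≡ (⊇ C∈) B∈ i∈C i∈B) C∈

  -- Enumerations

  words-complete : ∀ {A : Set} {xs : List A} → (∀ x → x ∈ˡ xs) → ∀ {m} (w : Vec A m) → w ∈ˡ words xs m
  words-complete xs-complete []      = here refl
  words-complete xs-complete (x ∷ w) = ∈-cartesianProductWith⁺ _∷_ (xs-complete x) (words-complete xs-complete w)

  words-unique : ∀ {A : Set} {xs : List A} → Unique xs → ∀ m → Unique (words xs m)
  words-unique xs! zero    = [] ∷ []
  words-unique xs! (suc m) = Unique.cartesianProductWith⁺ _∷_ Vec.∷-injective xs! (words-unique xs! m)

  concatMap-unique : ∀ {A B : Set} {f : A → List B} {xs} → (∀ x → Unique (f x)) →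
    (∀ {x y z} → z ∈ˡ f x → z ∈ˡ f y → x ≡ y) → Unique xs → Unique (concatMap f xs)
  concatMap-unique {xs = xs} f! disjoint xs! = Unique.concat⁺ (All.map⁺ (All.universal f! xs))
    (AllPairs.map⁺ (AllPairs.map (λ x≢y {_} (z∈x , z∈y) → x≢y (disjoint z∈x z∈y)) xs!))

  mapMaybe-complete : ∀ {A B : Set} {f : A → Maybe B} {xs x y} → x ∈ˡ xs → f x ≡ just y → y ∈ˡ List.mapMaybe f xs
  mapMaybe-complete {f = f} (here {x} refl) eq with f x
  mapMaybe-complete (here refl) refl | just y = here refl
  mapMaybe-complete {f = f} {x ∷ xs} (there x∈) eq with f x
  ... | just _  = there (mapMaybe-complete x∈ eq)
  ... | nothing = mapMaybe-complete x∈ eq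

  mapMaybe-sound : ∀ {A B : Set} {f : A → Maybe B} {xs y} → y ∈ˡ List.mapMaybe f xs → ∃ λ x → x ∈ˡ xs × f x ≡ just y
  mapMaybe-sound {f = f} {x ∷ xs} y∈ with f x in eq
  mapMaybe-sound {f = f} {x ∷ xs} (here refl) | just _ = x , here refl , eq
  mapMaybe-sound {f = f} {x ∷ xs} (there y∈) | just _ = let x , x∈ , e = mapMaybe-sound y∈ in x , there x∈ , e
  mapMaybe-sound {f = f} {x ∷ xs} y∈ | nothing = let x , x∈ , e = mapMaybe-sound y∈ in x , there x∈ , e

  mapMaybe-unique : ∀ {A B : Set} {f : A → Maybe B} {xs} → (∀ {x y z} → f x ≡ just z → f y ≡ just z → x ≡ y) →
    Unique xs → Unique (List.mapMaybe f xs)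
  mapMaybe-unique f-inj [] = []
  mapMaybe-unique {f = f} {x ∷ xs} f-inj (x∉ ∷ xs!) with f x in eq
  ... | nothing = mapMaybe-unique f-inj xs!
  ... | just y  = All.tabulate (λ {z} z∈ y≡z → let x′ , x′∈ , e = mapMaybe-sound z∈ in
                    All.lookup x∉ x′∈ (f-inj eq (trans e (cong just (sym y≡z))))) ∷ mapMaybe-unique f-inj xs!

  candidates : ∀ n → List (List (Subset n))
  candidates n = concatMap (λ k → map Vec.toList (words (words (inside ∷ outside ∷ []) n) k)) (List.applyUpTo suc n)

  -- This names the function local to the definition of partitions: at suc n the empty candidate is
  -- rejected by evaluation, and unification with the remaining list recovers the function.
  check : ∀ n → Σ (List (Subset (suc n)) → Maybe (Partition (suc n))) λ f →
    partitions (suc n) ≡ List.mapMaybe f (candidates (suc n))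
  check n = _ , refl

  check-just : ∀ {n} (Bs : List (Subset (suc n))) (p : IsPartition Bs) → proj₁ (check n) Bs ≡ just (partition Bs p)
  check-just Bs p with isPartition? Bs
  ... | yes q = refl
  ... | no ¬q = contradiction p ¬q

  check-just⁻ : ∀ {n} (Bs : List (Subset (suc n))) {π} → proj₁ (check n) Bs ≡ just π → blocks π ≡ Bs
  check-just⁻ Bs eq with isPartition? Bs
  check-just⁻ Bs refl | yes q = refl

  lookup-injective : ∀ {A : Set} {xs : List A} → Unique xs → ∀ k l → List.lookup xs k ≡ List.lookup xs l → k ≡ l
  lookup-injective (x∉ ∷ xs!) zero    zero    e = refl
  lookup-injective (x∉ ∷ xs!) zero    (suc l) e = contradiction e (All.lookup x∉ (∈-lookup l))
  lookup-injective (x∉ ∷ xs!) (suc k) zero    e = contradiction (sym e) (All.lookup x∉ (∈-lookup k))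
  lookup-injective (x∉ ∷ xs!) (suc k) (suc l) e = cong suc (lookup-injective xs! k l e)

  -- Choosing an element in each block injects the block indices into `Fin n`, as blocks that share
  -- an element coincide.
  length-blocks≤ : (π : Partition n) → List.length (blocks π) ≤ n
  length-blocks≤ π = Fin.injective⇒≤ {f = λ k → proj₁ (nonempty π (∈-lookup k))} λ {k} {l} e →
    lookup-injective (blocks-unique π) k l
      (overlap⇒≡ π (∈-lookup k) (∈-lookup l) (proj₂ (nonempty π (∈-lookup k)))
        (subst (_∈ _) (sym e) (proj₂ (nonempty π (∈-lookup l)))))

  sides-complete : ∀ b → b ∈ˡ inside ∷ outside ∷ []
  sides-complete inside  = here refl
  sides-complete outside = there (here refl)

  candidates-complete : (Bs : List (Subset n)) → 0 < List.length Bs → List.length Bs ≤ n → Bs ∈ˡ candidates n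
  candidates-complete (B ∷ Bs) _ ≤n = ∈-concatMap⁺ _ (lose (∈-applyUpTo⁺ suc ≤n)
    (subst (_∈ˡ map Vec.toList (words (words (inside ∷ outside ∷ []) _) (List.length (B ∷ Bs)))) (Vec.toList∘fromList (B ∷ Bs))
      (∈-map⁺ Vec.toList (words-complete (words-complete sides-complete) (Vec.fromList (B ∷ Bs))))))

  candidates-unique : ∀ n → Unique (candidates n)
  candidates-unique n = concatMap-unique
    (λ k → Unique.map⁺ (λ {v} {w} e → trans (sym (Vec.cast-is-id refl v)) (Vec.toList-injective refl v w e))
      (words-unique (words-unique (((λ ()) ∷ []) ∷ [] ∷ []) n) k))
    (λ z∈x z∈y → let v , _ , z≡v = ∈-map⁻ Vec.toList z∈x ; w , _ , z≡w = ∈-map⁻ Vec.toList z∈y in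
      trans (sym (Vec.length-toList v)) (trans (cong List.length (trans (sym z≡v) z≡w)) (Vec.length-toList w)))
    (Unique.applyUpTo⁺₁ suc n λ i<j _ e → ℕ.<⇒≢ i<j (ℕ.suc-injective e))

  partitions-complete : (π : Partition n) → π ∈ˡ partitions n
  -- `check` exists only at successors; at 0 the enumeration evaluates to a single partition, and
  -- any two relations on the empty set agree.
  partitions-complete {zero} π = here (∼-injective (λ { {()} }) (λ { {()} }))
  partitions-complete {suc n} π = subst (π ∈ˡ_) (sym (proj₂ (check n)))
    (mapMaybe-complete (candidates-complete (blocks π) (length-pos (proj₁ (proj₂ (blockOf π zero)))) (length-blocks≤ π))
      (check-just (blocks π) (isPartition′ π)))
    where
    length-pos : ∀ {B} {Bs : List (Subset (suc n))} → B ∈ˡ Bs → 0 < List.length Bs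
    length-pos (here _)  = s≤s z≤n
    length-pos (there _) = s≤s z≤n

  partitions-unique : ∀ n → Unique (partitions n)
  partitions-unique zero    = [] ∷ []
  partitions-unique (suc n) = subst Unique (sym (proj₂ (check n)))
    (mapMaybe-unique (λ {x} {y} e e′ → trans (sym (check-just⁻ x e)) (check-just⁻ y e′)) (candidates-unique (suc n)))

  -- Injectivity of Ψ

  ψ-∈ : (B : Subset n) → ∀ k → ψ B k ∈ B
  ψ-∈ (inside  ∷ B) zero    = here
  ψ-∈ (inside  ∷ B) (suc k) = there (ψ-∈ B k)
  ψ-∈ (outside ∷ B) k       = there (ψ-∈ B k)

  ψ-mono-< : (B : Subset n) → ∀ {k l} → k Fin.< l → ψ B k Fin.< ψ B l
  ψ-mono-< (inside  ∷ B) {zero}  {suc l} _         = s≤s z≤n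
  ψ-mono-< (inside  ∷ B) {suc k} {suc l} (s≤s k<l) = s≤s (ψ-mono-< B k<l)
  ψ-mono-< (outside ∷ B) k<l = s≤s (ψ-mono-< B k<l)

  ψ-injective : (B : Subset n) → ∀ {k l} → ψ B k ≡ ψ B l → k ≡ l
  ψ-injective B {k} {l} e with Fin.<-cmp k l
  ... | tri< k<l _ _ = contradiction e (Fin.<⇒≢ (ψ-mono-< B k<l))
  ... | tri≈ _ k≡l _ = k≡l
  ... | tri> _ _ l<k = contradiction (sym e) (Fin.<⇒≢ (ψ-mono-< B l<k))

  ψ-surjective : {B : Subset n} → ∀ {i} → i ∈ B → ∃ λ k → ψ B k ≡ i
  ψ-surjective {B = inside  ∷ B} here = zero , refl
  ψ-surjective {B = inside  ∷ B} (there i∈B) = let k , e = ψ-surjective i∈B in suc k , cong suc e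
  ψ-surjective {B = outside ∷ B} (there i∈B) = let k , e = ψ-surjective i∈B in k , cong suc e

  ψ-image : (B : Subset n) → Subset ∣ B ∣ → Subset n
  ψ-image B T = ⋃[ T ] (λ k → ⁅ ψ B k ⁆)

  ∈ψ-image⁺ : (B : Subset n) → ∀ {T k} → k ∈ T → ψ B k ∈ ψ-image B T
  ∈ψ-image⁺ B {T} {k} k∈T = ∈⋃⁺ {S = T} {λ k → ⁅ ψ B k ⁆} k∈T (x∈⁅x⁆ (ψ B k))

  ∈ψ-image⁻ : (B : Subset n) → ∀ {T i} → i ∈ ψ-image B T → ∃ λ k → k ∈ T × i ≡ ψ B k
  ∈ψ-image⁻ B {T} i∈ = let k , k∈T , i∈k = ∈⋃⁻ {S = T} {λ k → ⁅ ψ B k ⁆} i∈ in k , k∈T , x∈⁅y⁆⇒x≡y (ψ B k) i∈k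

  ∈-reduce⁺ : ∀ {A C : Set} {P : A → Set} (f : ∀ {x} → P x → List C) {xs} (ps : All P xs) {x z} (m : x ∈ˡ xs) →
    z ∈ˡ f (All.lookup ps m) → z ∈ˡ concat (All.reduce f ps)
  ∈-reduce⁺ f (p ∷ ps) (here refl) z∈ = ∈-++⁺ˡ z∈
  ∈-reduce⁺ f (p ∷ ps) (there m)   z∈ = ∈-++⁺ʳ (f p) (∈-reduce⁺ f ps m z∈)

  ∈-reduce⁻ : ∀ {A C : Set} {P : A → Set} (f : ∀ {x} → P x → List C) {xs} (ps : All P xs) {z} →
    z ∈ˡ concat (All.reduce f ps) → ∃ λ x → Σ (x ∈ˡ xs) λ m → z ∈ˡ f (All.lookup ps m)
  ∈-reduce⁻ f (p ∷ ps) z∈ with ∈-++⁻ (f p) z∈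
  ... | inj₁ z∈p = _ , here refl , z∈p
  ... | inj₂ z∈ps = let x , m , z∈x = ∈-reduce⁻ f ps z∈ps in x , there m , z∈x

  All-ext : ∀ {A : Set} {P : A → Set} {xs} (ps qs : All P xs) →
    (∀ {x} (m : x ∈ˡ xs) → All.lookup ps m ≡ All.lookup qs m) → ps ≡ qs
  All-ext []       []       _ = refl
  All-ext (p ∷ ps) (q ∷ qs) e = cong₂ _∷_ (e (here refl)) (All-ext ps qs (e ∘ there))

  module _ (t : ΨTuple n) where

    open Σ t using () renaming (proj₁ to τ; proj₂ to σs)

    ∈Ψ⁺ : ∀ {B T} (m : B ∈ˡ blocks τ) → T ∈ˡ blocks (All.lookup σs m) → ψ-image B T ∈ˡ Ψ t
    ∈Ψ⁺ {B} m T∈ = ∈-reduce⁺ (λ {B} σ → ψ-blocks {B = B} σ) σs m (∈-map⁺ (ψ-image B) T∈)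

    ∈Ψ⁻ : ∀ {S} → S ∈ˡ Ψ t → ∃ λ B → Σ (B ∈ˡ blocks τ) λ m → ∃ λ T → T ∈ˡ blocks (All.lookup σs m) × S ≡ ψ-image B T
    ∈Ψ⁻ S∈ = let B , m , S∈′ = ∈-reduce⁻ (λ {B} σ → ψ-blocks {B = B} σ) σs S∈ in B , m , ∈-map⁻ (ψ-image B) S∈′

    Ψ⇒∼ : ∀ {S i j} → S ∈ˡ Ψ t → i ∈ S → j ∈ S → _∼_ τ i j
    Ψ⇒∼ S∈ i∈S j∈S with ∈Ψ⁻ S∈
    ... | B , m , T , T∈ , refl with ∈ψ-image⁻ B i∈S | ∈ψ-image⁻ B j∈S
    ... | k , _ , refl | l , _ , refl = ∈⇒∼ τ m (ψ-∈ B k) (ψ-∈ B l)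

    -- The components of `σs` are indexed by membership proofs, so recognising the block `B` is not
    -- enough: since `blocks τ` has no repetitions, the two proofs `m` and `m′` are equal as well.
    Ψ⇒block : ∀ {S} → S ∈ˡ Ψ t → ∀ {B k} (m : B ∈ˡ blocks τ) → ψ B k ∈ S →
      ∃ λ T → T ∈ˡ blocks (All.lookup σs m) × S ≡ ψ-image B T × k ∈ T
    Ψ⇒block S∈ {B} m k∈S with ∈Ψ⁻ S∈
    ... | B′ , m′ , T , T∈ , refl with ∈ψ-image⁻ B′ k∈S
    ... | k′ , k′∈T , e with overlap⇒≡ τ m m′ (ψ-∈ B _) (subst (_∈ B′) (sym e) (ψ-∈ B′ k′))
    ... | refl with unique⇒irrelevant (blocks-unique τ) m m′ | ψ-injective B e
    ... | refl | refl = T , T∈ , refl , k′∈T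

    σ⇒Ψ : ∀ {B k l} (m : B ∈ˡ blocks τ) → _∼_ (All.lookup σs m) k l → ∃ λ S → S ∈ˡ Ψ t × ψ B k ∈ S × ψ B l ∈ S
    σ⇒Ψ {B} m k∼l = let T , T∈ , k∈T , l∈T = find k∼l in ψ-image B T , ∈Ψ⁺ m T∈ , ∈ψ-image⁺ B k∈T , ∈ψ-image⁺ B l∈T

    Ψ⇒σ : ∀ {B k l S} (m : B ∈ˡ blocks τ) → S ∈ˡ Ψ t → ψ B k ∈ S → ψ B l ∈ S → _∼_ (All.lookup σs m) k l
    Ψ⇒σ {B} m S∈ k∈S l∈S with Ψ⇒block S∈ m k∈S
    ... | T , T∈ , refl , k∈T with ∈ψ-image⁻ B l∈S
    ... | l′ , l′∈T , e with ψ-injective B e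
    ... | refl = ∈⇒∼ (All.lookup σs m) T∈ k∈T l′∈T

    Ψ-partition : ∃ λ π → Ψ t ≐ blocks π
    Ψ-partition = ≐-partition (Ψ t) Ψ-nonempty Ψ-overlap⇒≡ Ψ-cover
      where
      Ψ-nonempty : ∀ {S} → S ∈ˡ Ψ t → Nonempty S
      Ψ-nonempty S∈ with ∈Ψ⁻ S∈
      ... | B , m , T , T∈ , refl = let k , k∈T = nonempty (All.lookup σs m) T∈ in ψ B k , ∈ψ-image⁺ B k∈T

      Ψ-overlap⇒≡ : ∀ {S S′ i} → S ∈ˡ Ψ t → S′ ∈ˡ Ψ t → i ∈ S → i ∈ S′ → S ≡ S′
      Ψ-overlap⇒≡ {i = i} S∈ S′∈ i∈S i∈S′ with blockOf τ i
      ... | B , m , i∈B with ψ-surjective i∈B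
      ... | k , refl with Ψ⇒block S∈ m i∈S | Ψ⇒block S′∈ m i∈S′
      ... | T , T∈ , refl , k∈T | T′ , T′∈ , refl , k∈T′ =
        cong (ψ-image B) (overlap⇒≡ (All.lookup σs m) T∈ T′∈ k∈T k∈T′)

      Ψ-cover : ∀ i → ∃ λ S → S ∈ˡ Ψ t × i ∈ S
      Ψ-cover i with blockOf τ i
      ... | B , m , i∈B with ψ-surjective i∈B
      ... | k , refl = let T , T∈ , k∈T = blockOf (All.lookup σs m) k in ψ-image B T , ∈Ψ⁺ m T∈ , ∈ψ-image⁺ B k∈T

  -- Connected partitions inside noncrossing relations

  closed⇒splits : (π : Partition n) (S : Subset n) → (∀ {i j} → i ∈ S → _∼_ π i j → j ∈ S) → Splits π S
  -- The blocks selected are those that meet `S`; as `S` is closed under the relation, they lie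
  -- inside it.
  closed⇒splits π S closed = ⟦ meets? ⟧ , ⊆-antisym ⊆ ⊇
    where
    meets? : Decidable (λ k → Nonempty (List.lookup (blocks π) k ∩ S))
    meets? k = nonempty? (List.lookup (blocks π) k ∩ S)

    ⊆ : ∀ {i} → i ∈ S → i ∈ ⋃[ ⟦ meets? ⟧ ] (List.lookup (blocks π))
    ⊆ {i} i∈S = let B , B∈ , i∈B = blockOf π i ; i∈ = subst (i ∈_) (Any.lookup-index B∈) i∈B in
      ∈⋃⁺ {S = ⟦ meets? ⟧} {List.lookup (blocks π)} (∈⟦⟧⁺ meets? (i , x∈p∩q⁺ (i∈ , i∈S))) i∈

    ⊇ : ∀ {i} → i ∈ ⋃[ ⟦ meets? ⟧ ] (List.lookup (blocks π)) → i ∈ S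
    ⊇ i∈ = let k , k∈ , i∈k = ∈⋃⁻ {S = ⟦ meets? ⟧} {List.lookup (blocks π)} i∈
               j , j∈ = ∈⟦⟧⁻ meets? k∈
               j∈k , j∈S = x∈p∩q⁻ _ S j∈
           in closed j∈S (∈⇒∼ π (∈-lookup k) j∈k i∈k)

  Noncrossing : (Fin n → Fin n → Set) → Set
  Noncrossing R = ∀ i j k l → i Fin.< j → j Fin.< k → k Fin.< l → R i k → R j l → R i j

  -- If R is not total, let k be the least element outside the class of 0 and l the next element of
  -- that class (or n): no element of the interval [k, l) is related to one outside it.
  connected⇒total : (σ : Partition n) → Connected σ → {R : Fin n → Fin n → Set} (R? : ∀ i j → Dec (R i j)) →
    IsEquivalence R → Noncrossing R → (∀ {i j} → _∼_ σ i j → R i j) → ∀ i j → R i j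
  connected⇒total {zero}  σ conn R? equiv nc ⊆R ()
  connected⇒total {suc n} σ conn {R} R? equiv nc ⊆R i j = R.trans (R.sym (R0 i)) (R0 j)
    where
    module R = IsEquivalence equiv

    splitting : ∀ (k : Fin (suc n)) l → ¬ R zero k → toℕ k < l → l ≤ suc n →
      (∀ {i j} → toℕ k ≤ toℕ i → toℕ i < l → R i j → toℕ k ≤ toℕ j × toℕ j < l) → ⊥
    splitting k l ¬R0k k<l l≤n closed = conn p q (subst (p <_) (sym p+q≡l) k<l)
      (subst (_≤ suc n) (sym p+q≡l) l≤n)
      (ℕ.<-≤-trans (subst (q <_) p+q≡l (ℕ.m<n+m q 0<p)) l≤n)
      (closed⇒splits σ (interval p q) λ {i} {j} i∈ i∼j →
        let p≤i , i<p+q = ∈⟦⟧⁻ (in? i) i∈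
            p≤j , j<l = closed p≤i (subst (toℕ i <_) p+q≡l i<p+q) (⊆R i∼j)
        in ∈⟦⟧⁺ (in? j) (p≤j , subst (toℕ j <_) (sym p+q≡l) j<l))
      where
      p = toℕ k
      q = l ∸ p
      p+q≡l : p + q ≡ l
      p+q≡l = ℕ.m+[n∸m]≡n (ℕ.<⇒≤ k<l)
      in? : Fin (suc n) → Decidable (λ (i : Fin (suc n)) → p ≤ toℕ i × toℕ i < p + q)
      in? _ i = (p ℕ.≤? toℕ i) ×-dec (toℕ i ℕ.<? p + q)
      -- This makes the interval proper: q < p + q = l ≤ suc n.
      0<p : 0 < p
      0<p = ℕ.n≢0⇒n>0 λ p≡0 → ¬R0k (subst (R zero) (Fin.toℕ-injective (sym p≡0)) R.refl)

    R0 : ∀ k → R zero k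
    R0 k = decidable-stable (R? zero k) λ ¬R0k → absurd (least (λ k → ¬? (R? zero k)) (k , ¬R0k))
      where
      absurd : (∃ λ k → ¬ R zero k × (∀ j → ¬ R zero j → k Fin.≤ j)) → ⊥
      absurd (k , ¬R0k , k≤) with Fin.any? (λ l → (k Fin.<? l) ×-dec R? zero l)
      ... | no ¬l = splitting k (suc n) ¬R0k (Fin.toℕ<n k) ℕ.≤-refl λ {i} {j} k≤i _ Rij →
        k≤ j (λ R0j → unrelated k≤i (R.trans R0j (R.sym Rij))) , Fin.toℕ<n j
        where
        unrelated : ∀ {i} → k Fin.≤ i → ¬ R zero i
        unrelated {i} k≤i R0i with k Fin.≟ i
        ... | yes refl = ¬R0k R0i
        ... | no k≢i   = ¬l (i , Fin.≤∧≢⇒< k≤i k≢i , R0i)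
      ... | yes ∃l with least (λ l → (k Fin.<? l) ×-dec R? zero l) ∃l
      ... | l , (k<l , R0l) , l≤ = splitting k (toℕ l) ¬R0k k<l (ℕ.<⇒≤ (Fin.toℕ<n l)) λ {i} {j} k≤i i<l Rij →
        k≤ j (λ R0j → unrelated k≤i i<l (R.trans R0j (R.sym Rij))) , ℕ.≰⇒> λ l≤j → beyond k≤i i<l Rij l≤j
        where
        unrelated : ∀ {i} → k Fin.≤ i → i Fin.< l → ¬ R zero i
        unrelated {i} k≤i i<l R0i with k Fin.≟ i
        ... | yes refl = ¬R0k R0i
        ... | no k≢i   = ℕ.<⇒≱ i<l (l≤ i (Fin.≤∧≢⇒< k≤i k≢i , R0i))

        0< : ∀ {i : Fin (suc n)} → k Fin.≤ i → zero {n} Fin.< i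
        0< {zero}  k≤i = contradiction (subst (R zero) (Fin.toℕ-injective (sym (ℕ.n≤0⇒n≡0 k≤i))) R.refl) ¬R0k
        0< {suc i} k≤i = s≤s z≤n

        beyond : ∀ {i j} → k Fin.≤ i → i Fin.< l → R i j → ¬ l Fin.≤ j
        beyond {i} {j} k≤i i<l Rij l≤j with l Fin.≟ j
        ... | yes refl = unrelated k≤i i<l (R.trans R0l (R.sym Rij))
        -- Here 0 < i < l < j with 0 related to l and i to j, so noncrossing would put i into the
        -- class of 0, although i lies in the gap.
        ... | no l≢j   = unrelated k≤i i<l (nc zero i l j (0< k≤i) i<l (Fin.≤∧≢⇒< l≤j l≢j) R0l Rij)

  module _ (t t′ : ΨTuple n) where

    open Σ t using () renaming (proj₁ to τ; proj₂ to σs)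
    open Σ t′ using () renaming (proj₁ to τ′; proj₂ to σs′)

    -- The relation of τ′, pulled back along `ψ B`, is a noncrossing equivalence that contains the
    -- connected partition σ of `B`. It is therefore total, that is, `B` lies within one block of
    -- τ′.
    Ψ-refines : (∀ {B} (m : B ∈ˡ blocks τ) → CO (All.lookup σs m)) → NC τ′ →
      (∀ {S} → S ∈ˡ Ψ t → S ∈ˡ Ψ t′) → ∀ {i j} → _∼_ τ i j → _∼_ τ′ i j
    Ψ-refines co nc ⊆ i∼j with find i∼j
    ... | B , m , i∈B , j∈B with ψ-surjective i∈B | ψ-surjective j∈B
    ... | k , refl | l , refl = connected⇒total (All.lookup σs m) (co m)
      {R = λ k l → _∼_ τ′ (ψ B k) (ψ B l)}
      (λ k l → _∼?_ τ′ (ψ B k) (ψ B l))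
      (record { refl = ∼-refl τ′ ; sym = ∼-sym τ′ ; trans = ∼-trans τ′ })
      (λ i j k l i<j j<k k<l → nc _ _ _ _ (ψ-mono-< B i<j) (ψ-mono-< B j<k) (ψ-mono-< B k<l))
      (λ k∼l → let S , S∈ , k∈S , l∈S = σ⇒Ψ t m k∼l in Ψ⇒∼ t′ (⊆ S∈) k∈S l∈S)
      k l

  module _ (t t′ : ΨTuple n) where

    open Σ t using () renaming (proj₁ to τ; proj₂ to σs)
    open Σ t′ using () renaming (proj₁ to τ′; proj₂ to σs′)

    Ψ-injective₁ : NC τ → (∀ {B} (m : B ∈ˡ blocks τ) → CO (All.lookup σs m)) →
      NC τ′ → (∀ {B} (m : B ∈ˡ blocks τ′) → CO (All.lookup σs′ m)) → Ψ t ≐ Ψ t′ → τ ≡ τ′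
    Ψ-injective₁ nc co nc′ co′ (⊆ , ⊇) = ∼-injective (Ψ-refines t t′ co nc′ ⊆) (Ψ-refines t′ t co′ nc ⊇)

  -- With the equality of the first components as a hypothesis, matching on it gives the two
  -- families of σ's the same type.
  Ψ-injective₂ : ∀ (t t′ : ΨTuple n) → proj₁ t ≡ proj₁ t′ → Ψ t ≐ Ψ t′ → t ≡ t′
  Ψ-injective₂ t@(τ , σs) t′@(.τ , σs′) refl (⊆ , ⊇) = cong (τ ,_) (All-ext σs σs′ λ m → ∼-injective
    (λ k∼l → let S , S∈ , k∈S , l∈S = σ⇒Ψ t m k∼l in Ψ⇒σ t′ m (⊆ S∈) k∈S l∈S)
    (λ k∼l → let S , S∈ , k∈S , l∈S = σ⇒Ψ t′ m k∼l in Ψ⇒σ t m (⊇ S∈) k∈S l∈S))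

  module _ {A : Set} {P : A → Set} {f : ∀ x → List (P x)} where

    choices-sound : ∀ {xs ps} → ps ∈ˡ choices f xs → ∀ {x} (m : x ∈ˡ xs) → All.lookup ps m ∈ˡ f x
    choices-sound {y ∷ ys} ps∈ m with ∈-cartesianProductWith⁻ _∷_ (f y) (choices f ys) ps∈
    choices-sound ps∈ (here refl) | p , ps , p∈ , ps∈′ , refl = p∈
    choices-sound ps∈ (there m)   | p , ps , p∈ , ps∈′ , refl = choices-sound ps∈′ m

    choices-unique : (∀ x → Unique (f x)) → ∀ xs → Unique (choices f xs)
    choices-unique f! []       = [] ∷ []
    choices-unique f! (x ∷ xs) = Unique.cartesianProductWith⁺ _∷_ (λ { refl → refl , refl }) (f! x) (choices-unique f! xs)

  Ψ-tuples-sound : {t : ΨTuple n} → t ∈ˡ Ψ-tuples n →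
    NC (proj₁ t) × (∀ {B} (m : B ∈ˡ blocks (proj₁ t)) → CO (All.lookup (proj₂ t) m))
  Ψ-tuples-sound {n} t∈ with find (∈-concatMap⁻ _ {xs = filter nc? (partitions n)} t∈)
  ... | τ , τ∈ , t∈τ with ∈-map⁻ (τ ,_) t∈τ
  ... | σs , σs∈ , refl = proj₂ (∈-filter⁻ nc? {xs = partitions n} τ∈) ,
    λ {B} m → proj₂ (∈-filter⁻ co? {xs = partitions ∣ B ∣} (choices-sound σs∈ m))

  Ψ-tuples-unique : ∀ n → Unique (Ψ-tuples n)
  Ψ-tuples-unique n = concatMap-unique
    (λ τ → Unique.map⁺ (λ { refl → refl })
      (choices-unique (λ B → Unique.filter⁺ co? (partitions-unique ∣ B ∣)) (blocks τ)))
    (λ z∈ z∈′ → let _ , _ , e = ∈-map⁻ _ z∈ ; _ , _ , e′ = ∈-map⁻ _ z∈′ in cong proj₁ (trans (sym e) e′))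
    (Unique.filter⁺ nc? (partitions-unique n))

  -- Decomposition of noncrossing partitions

  -- Coordinates on g + h + 1 points: the least point, the gap of g points before the next point of
  -- its block, and the remaining h points. Case analysis on them replaces arithmetic in `Fin`.
  data Loc (g h : ℕ) : Set where
    root  : Loc g h
    left  : Fin g → Loc g h
    right : Fin h → Loc g h

  -- The default `∅` covers h = 0: joined with the new point it yields a singleton block.
  hd : ∀ {h} → List (Subset h) → Subset h
  hd []      = ∅
  hd (B ∷ _) = B

  tl : ∀ {h} → List (Subset h) → List (Subset h)
  tl []       = []
  tl (_ ∷ Bs) = Bs

  module _ {g h : ℕ} where

    embed : Loc g h → Fin (suc (g + h))
    embed root      = zero
    embed (left i)  = suc (i ↑ˡ h)
    embed (right j) = suc (g ↑ʳ j)

    locate : ∀ x → ∃ λ ℓ → embed ℓ ≡ x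
    locate zero = root , refl
    locate (suc x) with Fin.splitAt g x | Fin.join-splitAt g h x
    ... | inj₁ i | e = left i , cong suc e
    ... | inj₂ j | e = right j , cong suc e

    infix 4 _≺ᴸ_

    _≺ᴸ_ : Loc g h → Loc g h → Set
    root    ≺ᴸ root    = ⊥
    root    ≺ᴸ _       = ⊤
    left i  ≺ᴸ left j  = i Fin.< j
    left _  ≺ᴸ right _ = ⊤
    right i ≺ᴸ right j = i Fin.< j
    _       ≺ᴸ _       = ⊥

    left<right : ∀ (i : Fin g) (j : Fin h) → toℕ (i ↑ˡ h) < toℕ (g ↑ʳ j)
    left<right i j = subst₂ _<_ (sym (Fin.toℕ-↑ˡ i h)) (sym (Fin.toℕ-↑ʳ g j)) (ℕ.<-≤-trans (Fin.toℕ<n i) (ℕ.m≤m+n g (toℕ j)))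

    embed-mono : ∀ ℓ ℓ′ → ℓ ≺ᴸ ℓ′ → embed ℓ Fin.< embed ℓ′
    embed-mono root      (left _)  _   = s≤s z≤n
    embed-mono root      (right _) _   = s≤s z≤n
    embed-mono (left i)  (left j)  i<j = s≤s (subst₂ _<_ (sym (Fin.toℕ-↑ˡ i h)) (sym (Fin.toℕ-↑ˡ j h)) i<j)
    embed-mono (left i)  (right j) _   = s≤s (left<right i j)
    embed-mono (right i) (right j) i<j = s≤s (subst₂ _<_ (sym (Fin.toℕ-↑ʳ g i)) (sym (Fin.toℕ-↑ʳ g j)) (ℕ.+-monoʳ-< g i<j))

    embed-cancel : ∀ ℓ ℓ′ → embed ℓ Fin.< embed ℓ′ → ℓ ≺ᴸ ℓ′
    embed-cancel root      (left _)  _ = tt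
    embed-cancel root      (right _) _ = tt
    embed-cancel (left i)  (left j)  (s≤s i<j) = subst₂ _<_ (Fin.toℕ-↑ˡ i h) (Fin.toℕ-↑ˡ j h) i<j
    embed-cancel (left i)  (right j) _ = tt
    embed-cancel (right i) (left j)  (s≤s i<j) = ℕ.<-asym i<j (left<right j i)
    embed-cancel (right i) (right j) (s≤s i<j) =
      ℕ.+-cancelˡ-< g _ _ (subst₂ _<_ (Fin.toℕ-↑ʳ g i) (Fin.toℕ-↑ʳ g j) i<j)

    ++-∈ˡ⁺ : {S : Subset g} {T : Subset h} {i : Fin g} → i ∈ S → i ↑ˡ h ∈ S ++ T
    ++-∈ˡ⁺ {S} {T} {i} i∈ = Vec.lookup⇒[]= _ _ (trans (Vec.lookup-++ˡ S T i) (Vec.[]=⇒lookup i∈))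

    ++-∈ˡ⁻ : {S : Subset g} {T : Subset h} {i : Fin g} → i ↑ˡ h ∈ S ++ T → i ∈ S
    ++-∈ˡ⁻ {S} {T} {i} i∈ = Vec.lookup⇒[]= _ _ (trans (sym (Vec.lookup-++ˡ S T i)) (Vec.[]=⇒lookup i∈))

    ++-∈ʳ⁺ : (S : Subset g) {T : Subset h} {j : Fin h} → j ∈ T → g ↑ʳ j ∈ S ++ T
    ++-∈ʳ⁺ S {T} {j} j∈ = Vec.lookup⇒[]= _ _ (trans (Vec.lookup-++ʳ S T j) (Vec.[]=⇒lookup j∈))

    ++-∈ʳ⁻ : (S : Subset g) {T : Subset h} {j : Fin h} → g ↑ʳ j ∈ S ++ T → j ∈ T
    ++-∈ʳ⁻ S {T} {j} j∈ = Vec.lookup⇒[]= _ _ (trans (sym (Vec.lookup-++ʳ S T j)) (Vec.[]=⇒lookup j∈))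

    rootBlock rightBlock : Subset h → Subset (suc (g + h))
    rootBlock T  = inside ∷ (∅ {g} ++ T)
    rightBlock T = outside ∷ (∅ {g} ++ T)

    leftBlock : Subset g → Subset (suc (g + h))
    leftBlock S = outside ∷ (S ++ ∅ {h})

    InRoot InRight : Subset h → Loc g h → Set
    InRoot T root      = ⊤
    InRoot T (left _)  = ⊥
    InRoot T (right j) = j ∈ T
    InRight T (right j) = j ∈ T
    InRight T _         = ⊥

    InLeft : Subset g → Loc g h → Set
    InLeft S (left i) = i ∈ S
    InLeft S _        = ⊥

    rootBlock⁺ : ∀ {T} ℓ → InRoot T ℓ → embed ℓ ∈ rootBlock T
    rootBlock⁺ root      _  = here
    rootBlock⁺ (right j) j∈ = there (++-∈ʳ⁺ ∅ j∈)

    rootBlock⁻ : ∀ {T} ℓ → embed ℓ ∈ rootBlock T → InRoot T ℓ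
    rootBlock⁻ root      _          = tt
    rootBlock⁻ (left i)  (there i∈) = ∉⊥ (++-∈ˡ⁻ i∈)
    rootBlock⁻ (right j) (there j∈) = ++-∈ʳ⁻ ∅ j∈

    leftBlock⁺ : ∀ {S} ℓ → InLeft S ℓ → embed ℓ ∈ leftBlock S
    leftBlock⁺ (left i) i∈ = there (++-∈ˡ⁺ i∈)

    leftBlock⁻ : ∀ {S} ℓ → embed ℓ ∈ leftBlock S → InLeft S ℓ
    leftBlock⁻     (left i)  (there i∈) = ++-∈ˡ⁻ i∈
    leftBlock⁻ {S} (right j) (there j∈) = ∉⊥ (++-∈ʳ⁻ S j∈)

    rightBlock⁺ : ∀ {T} ℓ → InRight T ℓ → embed ℓ ∈ rightBlock T
    rightBlock⁺ (right j) j∈ = there (++-∈ʳ⁺ ∅ j∈)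

    rightBlock⁻ : ∀ {T} ℓ → embed ℓ ∈ rightBlock T → InRight T ℓ
    rightBlock⁻ (left i)  (there i∈) = ∉⊥ (++-∈ˡ⁻ i∈)
    rightBlock⁻ (right j) (there j∈) = ++-∈ʳ⁻ ∅ j∈

    -- Given the characterisations P and Q of S and T on locations, disjointness and order are
    -- decided location by location.
    empty-∩ : ∀ {S T} {P Q : Loc g h → Set} → (∀ ℓ → embed ℓ ∈ S → P ℓ) → (∀ ℓ → embed ℓ ∈ T → Q ℓ) →
      (∀ ℓ → P ℓ → Q ℓ → ⊥) → Empty (S ∩ T)
    empty-∩ {S} {T} p q disj (x , x∈) with locate x
    ... | ℓ , refl = let x∈S , x∈T = x∈p∩q⁻ S T x∈ in disj ℓ (p ℓ x∈S) (q ℓ x∈T)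

    ≺-embed : ∀ {S T} {Q : Loc g h → Set} ℓ → embed ℓ ∈ S → (∀ ℓ → embed ℓ ∈ T → Q ℓ) →
      (∀ ℓ′ → Q ℓ′ → ℓ ≺ᴸ ℓ′) → S ≺ T
    ≺-embed {T = T} ℓ ℓ∈S q < = embed ℓ , ℓ∈S , below
      where
      below : ∀ x → x ∈ T → embed ℓ Fin.< x
      below x x∈T with locate x
      ... | ℓ′ , refl = embed-mono ℓ ℓ′ (< ℓ′ (q ℓ′ x∈T))

    -- The new least element joins the first block of β, or forms a block by itself if h = 0.
    joinBlocks : List (Subset g) → List (Subset h) → List (Subset (suc (g + h)))
    joinBlocks As Bs = rootBlock (hd Bs) ∷ map leftBlock As List.++ map rightBlock (tl Bs)

    -- Root block, left blocks, right blocks is the order of the minima, because the root is the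
    -- least point and every left point precedes every right one; within the groups the order is
    -- inherited.
    join-isPartition : ∀ {As Bs} → IsPartition As → IsPartition Bs → IsPartition (joinBlocks As Bs)
    join-isPartition {As} {Bs} (As-ne , As-disj , As-cov , As-↗) (Bs-ne , Bs-disj , Bs-cov , Bs-↗) =
        (zero , here) ∷ All.++⁺
          (All.map⁺ (All.map (λ (i , i∈) → embed (left i) , leftBlock⁺ (left i) i∈) As-ne))
          (All.map⁺ (All.map (λ (j , j∈) → embed (right j) , rightBlock⁺ (right j) j∈) (tl-All Bs-ne)))
      , All.++⁺
          (All.map⁺ (All.universal (λ A → empty-∩ rootBlock⁻ (leftBlock⁻ {A}) λ { (left _) () }) As))
          (All.map⁺ (All.map (λ {B} d → empty-∩ rootBlock⁻ (rightBlock⁻ {B})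
            λ { (right j) j∈ j∈′ → d (j , x∈p∩q⁺ (j∈ , j∈′)) }) (hd-All Bs-disj)))
        ∷ AllPairs.++⁺
          (AllPairs.map⁺ (AllPairs.map (λ {A} {A′} d → empty-∩ (leftBlock⁻ {A}) (leftBlock⁻ {A′})
            λ { (left i) i∈ i∈′ → d (i , x∈p∩q⁺ (i∈ , i∈′)) }) As-disj))
          (AllPairs.map⁺ (AllPairs.map (λ {B} {B′} d → empty-∩ (rightBlock⁻ {B}) (rightBlock⁻ {B′})
            λ { (right j) j∈ j∈′ → d (j , x∈p∩q⁺ (j∈ , j∈′)) }) (tl-AllPairs Bs-disj)))
          (All.map⁺ (All.universal (λ A → All.map⁺ (All.universal (λ B →
            empty-∩ (leftBlock⁻ {A}) (rightBlock⁻ {B}) λ { (left _) _ () }) (tl Bs))) As))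
      , cover
      , All.++⁺
          (All.map⁺ (All.universal (λ A → ≺-embed root here (leftBlock⁻ {A}) λ { (left _) _ → tt }) As))
          (All.map⁺ (All.universal (λ B → ≺-embed root here (rightBlock⁻ {B}) λ { (right _) _ → tt }) (tl Bs)))
        ∷ AllPairs.++⁺
          (AllPairs.map⁺ (AllPairs.map (λ {A} {A′} (i , i∈ , <) →
            ≺-embed (left i) (leftBlock⁺ (left i) i∈) (leftBlock⁻ {A′}) λ { (left j) → < j }) As-↗))
          (AllPairs.map⁺ (AllPairs.map (λ {B} {B′} (i , i∈ , <) →
            ≺-embed (right i) (rightBlock⁺ (right i) i∈) (rightBlock⁻ {B′}) λ { (right j) → < j }) (tl-AllPairs Bs-↗)))
          (All.map⁺ (All.map (λ {A} (i , i∈) → All.map⁺ (All.universal (λ B →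
            ≺-embed (left i) (leftBlock⁺ (left i) i∈) (rightBlock⁻ {B}) λ { (right _) _ → tt }) (tl Bs))) As-ne))
      where
      tl-All : ∀ {P : Subset h → Set} {Bs} → All P Bs → All P (tl Bs)
      tl-All []       = []
      tl-All (_ ∷ ps) = ps

      hd-All : ∀ {R : Subset h → Subset h → Set} {Bs} → AllPairs R Bs → All (R (hd Bs)) (tl Bs)
      hd-All []       = []
      hd-All (rs ∷ _) = rs

      tl-AllPairs : ∀ {R : Subset h → Subset h → Set} {Bs} → AllPairs R Bs → AllPairs R (tl Bs)
      tl-AllPairs []       = []
      tl-AllPairs (_ ∷ rs) = rs

      cover-right : ∀ {Bs j} → Any (j ∈_) Bs → Any (embed (right j) ∈_) (joinBlocks As Bs)
      cover-right (here j∈)  = here (rootBlock⁺ (right _) j∈)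
      cover-right (there j∈) = there (Any.++⁺ʳ _ (Any.map⁺ (Any.map (rightBlock⁺ (right _)) j∈)))

      cover : ∀ x → Any (x ∈_) (joinBlocks As Bs)
      cover x with locate x
      ... | root , refl    = here here
      ... | left i , refl  = there (Any.++⁺ˡ (Any.map⁺ (Any.map (leftBlock⁺ (left i)) (As-cov i))))
      ... | right j , refl = cover-right (Bs-cov j)

    join : Partition g → Partition h → Partition (suc (g + h))
    join α β = partition (joinBlocks (blocks α) (blocks β)) (join-isPartition (isPartition′ α) (isPartition′ β))

    module _ (α : Partition g) (β : Partition h) where

      JoinRel : Loc g h → Loc g h → Set
      JoinRel root      root      = ⊤
      JoinRel root      (right j) = j ∈ hd (blocks β)
      JoinRel (right i) root      = i ∈ hd (blocks β)
      JoinRel (left i)  (left j)  = _∼_ α i j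
      JoinRel (right i) (right j) = _∼_ β i j
      JoinRel _         _         = ⊥

      private
        hd⇒∼ : ∀ {i j} → i ∈ hd (blocks β) → j ∈ hd (blocks β) → _∼_ β i j
        hd⇒∼ i∈ j∈ = go (blocks β) i∈ j∈
          where
          go : ∀ Bs {i j} → i ∈ hd Bs → j ∈ hd Bs → Any (λ B → i ∈ B × j ∈ B) Bs
          go []      i∈ _  = contradiction i∈ ∉⊥
          go (_ ∷ _) i∈ j∈ = here (i∈ , j∈)

        tl⇒∈ : ∀ {B} {Bs : List (Subset h)} → B ∈ˡ tl Bs → B ∈ˡ Bs
        tl⇒∈ {Bs = _ ∷ _} B∈ = there B∈

      join-∼⁻ : ∀ ℓ ℓ′ → _∼_ (join α β) (embed ℓ) (embed ℓ′) → JoinRel ℓ ℓ′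
      join-∼⁻ ℓ ℓ′ (here (ℓ∈ , ℓ′∈)) = go ℓ ℓ′ (rootBlock⁻ ℓ ℓ∈) (rootBlock⁻ ℓ′ ℓ′∈)
        where
        go : ∀ ℓ ℓ′ → InRoot (hd (blocks β)) ℓ → InRoot (hd (blocks β)) ℓ′ → JoinRel ℓ ℓ′
        go root      root      _  _  = tt
        go root      (right j) _  j∈ = j∈
        go (right i) root      i∈ _  = i∈
        go (right i) (right j) i∈ j∈ = hd⇒∼ i∈ j∈
      join-∼⁻ ℓ ℓ′ (there ℓ∼ℓ′) with Any.++⁻ (map leftBlock (blocks α)) ℓ∼ℓ′
      ... | inj₁ p = let A , A∈ , ℓ∈ , ℓ′∈ = find (Any.map⁻ p) in go ℓ ℓ′ A∈ (leftBlock⁻ ℓ ℓ∈) (leftBlock⁻ ℓ′ ℓ′∈)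
        where
        go : ∀ ℓ ℓ′ {A} → A ∈ˡ blocks α → InLeft A ℓ → InLeft A ℓ′ → JoinRel ℓ ℓ′
        go (left i) (left j) A∈ i∈ j∈ = lose A∈ (i∈ , j∈)
      ... | inj₂ p = let B , B∈ , ℓ∈ , ℓ′∈ = find (Any.map⁻ p) in go ℓ ℓ′ B∈ (rightBlock⁻ ℓ ℓ∈) (rightBlock⁻ ℓ′ ℓ′∈)
        where
        go : ∀ ℓ ℓ′ {B} → B ∈ˡ tl (blocks β) → InRight B ℓ → InRight B ℓ′ → JoinRel ℓ ℓ′
        go (right i) (right j) B∈ i∈ j∈ = lose (tl⇒∈ B∈) (i∈ , j∈)

      join-∼⁺ : ∀ ℓ ℓ′ → JoinRel ℓ ℓ′ → _∼_ (join α β) (embed ℓ) (embed ℓ′)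
      join-∼⁺ root      root      _   = here (here , here)
      join-∼⁺ root      (right j) j∈  = here (here , rootBlock⁺ (right j) j∈)
      join-∼⁺ (right i) root      i∈  = here (rootBlock⁺ (right i) i∈ , here)
      join-∼⁺ (left i)  (left j)  i∼j = there (Any.++⁺ˡ (Any.map⁺ (Any.map
        (λ (i∈ , j∈) → leftBlock⁺ (left i) i∈ , leftBlock⁺ (left j) j∈) i∼j)))
      join-∼⁺ (right i) (right j) i∼j = go (blocks β) i∼j
        where
        go : ∀ Bs → Any (λ B → i ∈ B × j ∈ B) Bs →
          Any (λ B → embed (right i) ∈ B × embed (right j) ∈ B) (joinBlocks (blocks α) Bs)
        go (B ∷ _)  (here (i∈ , j∈)) = here (rootBlock⁺ (right i) i∈ , rootBlock⁺ (right j) j∈)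
        go (_ ∷ Bs) (there i∼j)      = there (Any.++⁺ʳ (map leftBlock (blocks α)) (Any.map⁺ (Any.map
          (λ (i∈ , j∈) → rightBlock⁺ (right i) i∈ , rightBlock⁺ (right j) j∈) i∼j)))

  -- The argument only witnesses that `h` is positive, so `h` need not be replaced by a successor
  -- where the function is used.
  first : ∀ {h} → Fin h → Fin h
  first {suc h} _ = zero

  toℕ-first : ∀ {h} (j : Fin h) → toℕ (first j) ≡ 0
  toℕ-first {suc h} _ = refl

  -- Blocks are sorted by minimum: if the block of 0 came later, the head would contain an element
  -- below 0.
  first∈hd : ∀ {h} (β : Partition h) (j : Fin h) → first j ∈ hd (blocks β)
  first∈hd {suc h} β _ = go (sorted β) (proj₁ (proj₂ (blockOf β zero))) (proj₂ (proj₂ (blockOf β zero)))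
    where
    go : ∀ {B Bs} → AllPairs _≺_ Bs → B ∈ˡ Bs → zero ∈ B → zero ∈ hd Bs
    go _        (here refl) 0∈B = 0∈B
    go (hd≺ ∷ _) (there B∈) 0∈B with All.lookup hd≺ B∈
    ... | _ , _ , <0 with () ← <0 zero 0∈B

  hd∈blocks : ∀ {h} (β : Partition h) → Fin h → hd (blocks β) ∈ˡ blocks β
  hd∈blocks β j = go (blocks β) (first∈hd β j)
    where
    go : ∀ Bs → first j ∈ hd Bs → hd Bs ∈ˡ Bs
    go []      j∈ = contradiction j∈ ∉⊥
    go (_ ∷ _) _  = here refl

  ∈hd⇒∼ : ∀ {h} (β : Partition h) {j} → j ∈ hd (blocks β) → _∼_ β (first j) j
  ∈hd⇒∼ β {j} j∈ = ∈⇒∼ β (hd∈blocks β j) (first∈hd β j) j∈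

  ∼⇒∈hd : ∀ {h} (β : Partition h) {j} → _∼_ β (first j) j → j ∈ hd (blocks β)
  ∼⇒∈hd β {j} 0∼j = ∼⇒∈ β (hd∈blocks β j) (first∈hd β j) 0∼j

  -- Crossings within α or within β are excluded by hypothesis. The remaining case starts at the
  -- root, which is related to the same right points as the first point of β; so either j is that
  -- point, or the configuration is one in β with that point in place of the root.
  join-NC : ∀ {g h} {α : Partition g} {β : Partition h} → NC α → NC β → NC (join α β)
  join-NC {g} {h} {α} {β} ncα ncβ x y z w x<y y<z z<w x∼z y∼w
    with locate {g} {h} x | locate {g} {h} y | locate {g} {h} z | locate {g} {h} w
  ... | i , refl | j , refl | k , refl | l , refl =
    join-∼⁺ α β i j (nc i j k l (embed-cancel i j x<y) (embed-cancel j k y<z) (embed-cancel k l z<w)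
      (join-∼⁻ α β i k x∼z) (join-∼⁻ α β j l y∼w))
    where
    hd-NC : ∀ {h} {β : Partition h} → NC β → ∀ j k l → j Fin.< k → k Fin.< l →
      k ∈ hd (blocks β) → _∼_ β j l → j ∈ hd (blocks β)
    hd-NC {suc h} {β} nc zero    k l j<k k<l k∈ j∼l = first∈hd β zero
    hd-NC {suc h} {β} nc (suc j) k l j<k k<l k∈ j∼l = ∼⇒∈hd β (nc zero (suc j) k l (s≤s z≤n) j<k k<l (∈hd⇒∼ β k∈) j∼l)

    nc : ∀ i j k l → i ≺ᴸ j → j ≺ᴸ k → k ≺ᴸ l → JoinRel α β i k → JoinRel α β j l → JoinRel α β i j
    nc (left i)  (left j)  (left k)  (left l)  i<j j<k k<l i∼k j∼l = ncα i j k l i<j j<k k<l i∼k j∼l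
    nc (right i) (right j) (right k) (right l) i<j j<k k<l i∼k j∼l = ncβ i j k l i<j j<k k<l i∼k j∼l
    nc root      (right j) (right k) (right l) _   j<k k<l k∈  j∼l = hd-NC {β = β} ncβ j k l j<k k<l k∈ j∼l
    nc root      (left j)  (right k) (left l)  _   _   ()

  -- The second condition is vacuous for g = n, when zero is a block by itself.
  FirstReturn : ∀ {n} → ℕ → Partition (suc n) → Set
  FirstReturn {n} g ρ = (∀ x → 0 < toℕ x → toℕ x ≤ g → ¬ _∼_ ρ zero x) × (∀ x → toℕ x ≡ suc g → _∼_ ρ zero x)

  FirstReturn-≮ : ∀ {n g g′} (ρ : Partition (suc n)) → g′ ≤ n → FirstReturn g ρ → FirstReturn g′ ρ → ¬ g < g′
  FirstReturn-≮ {g′ = g′} ρ g′≤n (_ , at) (before′ , _) g<g′ = before′ x (subst (0 <_) (sym x≡1+g) (s≤s z≤n))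
    (subst (_≤ g′) (sym x≡1+g) g<g′) (at x x≡1+g)
    where
    1+g<1+n = s≤s (ℕ.≤-trans g<g′ g′≤n)
    x = fromℕ< 1+g<1+n
    x≡1+g = Fin.toℕ-fromℕ< 1+g<1+n

  FirstReturn-unique : ∀ {n g g′} (ρ : Partition (suc n)) → g ≤ n → g′ ≤ n → FirstReturn g ρ → FirstReturn g′ ρ → g ≡ g′
  FirstReturn-unique ρ g≤n g′≤n ret ret′ =
    ℕ.≤-antisym (ℕ.≮⇒≥ (FirstReturn-≮ ρ g≤n ret′ ret)) (ℕ.≮⇒≥ (FirstReturn-≮ ρ g′≤n ret ret′))

  FirstReturn-exists : ∀ {n} (ρ : Partition (suc n)) → ∃ λ g → g ≤ n × FirstReturn g ρ
  FirstReturn-exists {n} ρ with Fin.any? (λ x → _∼?_ ρ zero (suc x))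
  ... | no ¬x = n , ℕ.≤-refl , (λ { (suc x) _ _ 0∼x → ¬x (x , 0∼x) }) ,
    (λ x e → contradiction (Fin.toℕ<n x) (ℕ.<-irrefl e))
  ... | yes ∃x with least (λ x → _∼?_ ρ zero (suc x)) ∃x
  ... | k , 0∼k , k≤ = toℕ k , ℕ.<⇒≤ (Fin.toℕ<n k) ,
    (λ { (suc x) _ x<k 0∼x → ℕ.<⇒≱ x<k (k≤ x 0∼x) }) ,
    (λ x e → subst (_∼_ ρ zero) (Fin.toℕ-injective (sym e)) 0∼k)

  module _ {g h : ℕ} where

    join-FirstReturn : (α : Partition g) (β : Partition h) → FirstReturn g (join α β)
    join-FirstReturn α β = before , at
      where
      before : ∀ x → 0 < toℕ x → toℕ x ≤ g → ¬ _∼_ (join α β) zero x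
      before x 0<x x≤g 0∼x with locate {g} {h} x
      ... | left i , refl  = join-∼⁻ α β root (left i) 0∼x
      ... | right j , refl = ℕ.<⇒≱ (s≤s (subst (g ≤_) (sym (Fin.toℕ-↑ʳ g j)) (ℕ.m≤m+n g (toℕ j)))) x≤g

      hd∋0 : ∀ {h} (β : Partition h) (j : Fin h) → toℕ j ≡ 0 → j ∈ hd (blocks β)
      hd∋0 β zero _ = first∈hd β zero

      at : ∀ x → toℕ x ≡ suc g → _∼_ (join α β) zero x
      at x e with locate {g} {h} x
      ... | left i , refl  = contradiction (trans (sym (Fin.toℕ-↑ˡ i h)) (ℕ.suc-injective e)) (ℕ.<⇒≢ (Fin.toℕ<n i))
      ... | right j , refl = join-∼⁺ α β root (right j) (hd∋0 β j
        (ℕ.+-cancelˡ-≡ g _ _ (trans (sym (Fin.toℕ-↑ʳ g j)) (trans (ℕ.suc-injective e) (sym (ℕ.+-identityʳ g))))))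

    join-injective : (α α′ : Partition g) (β β′ : Partition h) → join α β ≡ join α′ β′ → α ≡ α′ × β ≡ β′
    join-injective α α′ β β′ e =
      ∼-injective (transfer α α′ β β′ e (left _) (left _)) (transfer α′ α β′ β (sym e) (left _) (left _)) ,
      ∼-injective (transfer α α′ β β′ e (right _) (right _)) (transfer α′ α β′ β (sym e) (right _) (right _))
      where
      transfer : ∀ (α α′ : Partition g) (β β′ : Partition h) → join α β ≡ join α′ β′ →
        ∀ ℓ ℓ′ → JoinRel α β ℓ ℓ′ → JoinRel α′ β′ ℓ ℓ′
      transfer α α′ β β′ e ℓ ℓ′ r = join-∼⁻ α′ β′ ℓ ℓ′
        (subst (λ ρ → _∼_ ρ (embed ℓ) (embed ℓ′)) e (join-∼⁺ α β ℓ ℓ′ r))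

  module _ {m n : ℕ} (f : Fin m → Fin n) (ρ : Partition n) where

    private
      R : Fin m → Fin m → Set
      R i j = _∼_ ρ (f i) (f j)

      R? : ∀ i j → Dec (R i j)
      R? i j = _∼?_ ρ (f i) (f j)

      R-isEquivalence : IsEquivalence R
      R-isEquivalence = record { refl = ∼-refl ρ ; sym = ∼-sym ρ ; trans = ∼-trans ρ }

    open Quotient R? R-isEquivalence public
      using () renaming (quotient to pullback; quotient-∼⁺ to pullback-∼⁺; quotient-∼⁻ to pullback-∼⁻)

    pullback-NC : (∀ {i j} → i Fin.< j → f i Fin.< f j) → NC ρ → NC pullback
    pullback-NC f-mono nc i j k l i<j j<k k<l i∼k j∼l =
      pullback-∼⁺ (nc _ _ _ _ (f-mono i<j) (f-mono j<k) (f-mono k<l) (pullback-∼⁻ i∼k) (pullback-∼⁻ j∼l))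

  module _ {g h : ℕ} where

    join-surjective : (ρ : Partition (suc (g + h))) → NC ρ → FirstReturn g ρ →
      ∃ λ (α : Partition g) → ∃ λ (β : Partition h) → NC α × NC β × join α β ≡ ρ
    join-surjective ρ nc (before , at) = α , β ,
      pullback-NC (embed ∘ left) ρ (embed-mono (left _) (left _)) nc ,
      pullback-NC (embed ∘ right) ρ (embed-mono (right _) (right _)) nc ,
      ∼-injective (λ {x} {y} → to′ x y) (λ {x} {y} → from′ x y)
      where
      α : Partition g
      α = pullback (embed {g} {h} ∘ left) ρ

      β : Partition h
      β = pullback (embed {g} {h} ∘ right) ρ

      at-first : ∀ (j : Fin h) → toℕ j ≡ 0 → _∼_ ρ zero (embed {g} {h} (right j))
      at-first j e = at _ (cong suc (trans (Fin.toℕ-↑ʳ g j) (trans (cong (g +_) e) (ℕ.+-identityʳ g))))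

      before-left : ∀ i → ¬ _∼_ ρ zero (embed (left i))
      before-left i = before _ (s≤s z≤n) (subst (_< g) (sym (Fin.toℕ-↑ˡ i h)) (Fin.toℕ<n i))

      -- The first right point is related to 0. A relation from a gap point to a later right point
      -- would cross this one and force the gap point into the class of 0, before the first return.
      cross : ∀ i j → ¬ _∼_ ρ (embed (left i)) (embed (right j))
      cross i j i∼j with first j Fin.≟ j
      ... | yes e = before-left i (∼-trans ρ (at-first j (trans (cong toℕ (sym e)) (toℕ-first j))) (∼-sym ρ i∼j))
      ... | no j≢first = before-left i (nc zero _ (embed (right (first j))) _ (s≤s z≤n)
        (embed-mono (left i) (right (first j)) tt)
        (embed-mono (right (first j)) (right j) (Fin.≤∧≢⇒< (subst (_≤ toℕ j) (sym (toℕ-first j)) z≤n) j≢first))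
        (at-first (first j) (toℕ-first j)) i∼j)

      to : ∀ ℓ ℓ′ → JoinRel α β ℓ ℓ′ → _∼_ ρ (embed ℓ) (embed ℓ′)
      to root      root      _   = ∼-refl ρ
      to root      (right j) j∈  = ∼-trans ρ (at-first (first j) (toℕ-first j)) (pullback-∼⁻ _ ρ (∈hd⇒∼ β j∈))
      to (right i) root      i∈  = ∼-sym ρ (to root (right i) i∈)
      to (left i)  (left j)  i∼j = pullback-∼⁻ _ ρ i∼j
      to (right i) (right j) i∼j = pullback-∼⁻ _ ρ i∼j

      from : ∀ ℓ ℓ′ → _∼_ ρ (embed ℓ) (embed ℓ′) → JoinRel α β ℓ ℓ′
      from root      root      _ = tt
      from root      (left j)  e = before-left j e
      from root      (right j) e = ∼⇒∈hd β (pullback-∼⁺ _ ρ (∼-trans ρ (∼-sym ρ (at-first (first j) (toℕ-first j))) e))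
      from (left i)  root      e = before-left i (∼-sym ρ e)
      from (left i)  (left j)  e = pullback-∼⁺ _ ρ e
      from (left i)  (right j) e = cross i j e
      from (right i) root      e = from root (right i) (∼-sym ρ e)
      from (right i) (left j)  e = cross j i (∼-sym ρ e)
      from (right i) (right j) e = pullback-∼⁺ _ ρ e

      to′ : ∀ x y → _∼_ (join α β) x y → _∼_ ρ x y
      to′ x y e with locate {g} {h} x | locate {g} {h} y
      ... | ℓ , refl | ℓ′ , refl = to ℓ ℓ′ (join-∼⁻ α β ℓ ℓ′ e)

      from′ : ∀ x y → _∼_ ρ x y → _∼_ (join α β) x y
      from′ x y e with locate {g} {h} x | locate {g} {h} y
      ... | ℓ , refl | ℓ′ , refl = join-∼⁺ α β ℓ ℓ′ (from ℓ ℓ′ e)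

  -- Enumerating the decompositions

  Split : ℕ → Set
  Split n = Σ ℕ λ g → Σ ℕ λ h → g + h ≡ n

  shift : ∀ {n} → Split n → Split (suc n)
  shift (g , h , e) = suc g , h , cong suc e

  split-≡ : ∀ {n} (s s′ : Split n) → proj₁ s ≡ proj₁ s′ → s ≡ s′
  split-≡ (g , h , refl) (.g , h′ , e) refl with ℕ.+-cancelˡ-≡ g h′ h e
  split-≡ (g , h , refl) (.g , .h , refl) refl | refl = refl

  -- The recursion follows the unfolding of `_⊛_`, so that a coefficient of a product becomes a sum
  -- over this list.
  splits : ∀ n → List (Split n)
  splits zero    = (0 , 0 , refl) ∷ []
  splits (suc n) = (0 , suc n , refl) ∷ map shift (splits n)

  splits-complete : ∀ {n} (s : Split n) → s ∈ˡ splits n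
  splits-complete (zero  , zero  , refl) = here refl
  splits-complete (zero  , suc h , refl) = here refl
  splits-complete (suc g , h     , refl) = there (∈-map⁺ shift (splits-complete (g , h , refl)))

  splits-unique : ∀ n → Unique (splits n)
  splits-unique zero    = [] ∷ []
  splits-unique (suc n) = All.map⁺ (All.universal (λ _ ()) (splits n)) ∷
    Unique.map⁺ (λ {s} {t} e → split-≡ s t (ℕ.suc-injective (cong proj₁ e))) (splits-unique n)

  JoinTuple : ℕ → Set
  JoinTuple n = Σ (Split n) λ (g , h , _) → Partition g × Partition h

  joinₜ : ∀ {n} → JoinTuple n → Partition (suc n)
  joinₜ ((_ , _ , e) , α , β) = subst (Partition ∘ suc) e (join α β)

  partitionsNC : ∀ n → List (Partition n)
  partitionsNC n = List.filter nc? (partitions n)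

  partitionsNC-unique : ∀ n → Unique (partitionsNC n)
  partitionsNC-unique n = Unique.filter⁺ nc? (partitions-unique n)

  partitionsNC-complete : ∀ {n} (π : Partition n) → NC π → π ∈ˡ partitionsNC n
  partitionsNC-complete π nc = ∈-filter⁺ nc? (partitions-complete π) nc

  partitionsNC-sound : ∀ {n} (π : Partition n) → π ∈ˡ partitionsNC n → NC π
  partitionsNC-sound {n} π π∈ = proj₂ (∈-filter⁻ nc? {xs = partitions n} π∈)

  join-tuples : ∀ n → List (JoinTuple n)
  join-tuples n = concatMap (λ s@(g , h , _) →
    map (s ,_) (cartesianProduct (partitionsNC g) (partitionsNC h))) (splits n)

  join-tuples-unique : ∀ n → Unique (join-tuples n)
  join-tuples-unique n = concatMap-unique
    (λ (g , h , _) → Unique.map⁺ (λ { refl → refl })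
      (Unique.cartesianProduct⁺ (partitionsNC-unique g) (partitionsNC-unique h)))
    (λ z∈ z∈′ → let _ , _ , e = ∈-map⁻ _ z∈ ; _ , _ , e′ = ∈-map⁻ _ z∈′ in cong proj₁ (trans (sym e) e′))
    (splits-unique n)

  join-tuples-sound : ∀ {n} (t@((g , h , _) , α , β) : JoinTuple n) → t ∈ˡ join-tuples n → NC α × NC β
  join-tuples-sound {n} t t∈ with find (∈-concatMap⁻ _ {xs = splits n} t∈)
  ... | s@(g , h , _) , _ , t∈s with ∈-map⁻ (s ,_) t∈s
  ... | (α , β) , αβ∈ , refl = let α∈ , β∈ = ∈-cartesianProduct⁻ (partitionsNC g) (partitionsNC h) αβ∈ in
    partitionsNC-sound α α∈ , partitionsNC-sound β β∈

  join-tuples-complete : ∀ {n} (t@((g , h , _) , α , β) : JoinTuple n) → NC α → NC β → t ∈ˡ join-tuples n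
  join-tuples-complete {n} (s , α , β) ncα ncβ = ∈-concatMap⁺ _ (lose (splits-complete s)
    (∈-map⁺ (s ,_) (∈-cartesianProduct⁺ (partitionsNC-complete α ncα) (partitionsNC-complete β ncβ))))

  joinₜ-FirstReturn : ∀ {n} (t : JoinTuple n) → FirstReturn (proj₁ (proj₁ t)) (joinₜ t)
  joinₜ-FirstReturn ((g , h , refl) , α , β) = join-FirstReturn α β

  split≤ : ∀ {n} (s : Split n) → proj₁ s ≤ n
  split≤ (g , h , refl) = ℕ.m≤m+n g h

  -- The size of the gap can be read off from the joined partition as its first return, so the
  -- splits agree. Matching on that removes the transports and leaves `join-injective`.
  joinₜ-injective : ∀ {n} {t u : JoinTuple n} → joinₜ t ≡ joinₜ u → t ≡ u
  joinₜ-injective {t = t@(s , _)} {u@(s′ , _)} e = same-split t u e (split-≡ s s′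
    (FirstReturn-unique (joinₜ u) (split≤ s) (split≤ s′)
      (subst (FirstReturn (proj₁ s)) e (joinₜ-FirstReturn t)) (joinₜ-FirstReturn u)))
    where
    same-split : ∀ {n} (t u : JoinTuple n) → joinₜ t ≡ joinₜ u → proj₁ t ≡ proj₁ u → t ≡ u
    same-split (s , αβ) (.s , αβ′) e refl = go s αβ αβ′ e
      where
      go : ∀ {n} (s@(g , h , _) : Split n) (αβ αβ′ : Partition g × Partition h) → joinₜ (s , αβ) ≡ joinₜ (s , αβ′) →
        _≡_ {A = JoinTuple n} (s , αβ) (s , αβ′)
      go (g , h , refl) (α , β) (α′ , β′) e = let α≡α′ , β≡β′ = join-injective α α′ β β′ e in
        cong₂ (λ α β → _ , α , β) α≡α′ β≡β′

  joinₜ-NC : ∀ {n} (t@(_ , α , β) : JoinTuple n) → NC α → NC β → NC (joinₜ t)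
  joinₜ-NC ((g , h , refl) , α , β) ncα ncβ = join-NC {α = α} {β} ncα ncβ

  joinₜ-surjective : ∀ {n} (ρ : Partition (suc n)) → NC ρ → ∃ λ (t : JoinTuple n) → t ∈ˡ join-tuples n × ρ ≡ joinₜ t
  joinₜ-surjective {n} ρ nc = let g , g≤n , ret = FirstReturn-exists ρ in go g (n ∸ g) (ℕ.m+[n∸m]≡n g≤n) ρ nc ret
    where
    go : ∀ {n} g h (e : g + h ≡ n) (ρ : Partition (suc n)) → NC ρ → FirstReturn g ρ →
      ∃ λ (t : JoinTuple n) → t ∈ˡ join-tuples n × ρ ≡ joinₜ t
    go g h refl ρ nc ret = let α , β , ncα , ncβ , e = join-surjective ρ nc ret in
      ((g , h , refl) , α , β) , join-tuples-complete ((g , h , refl) , α , β) ncα ncβ , sym e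

  -- Both lists are free of repetitions and have the same members, so they are permutations of each
  -- other and sums can be moved between them.
  joinₜ-↭ : ∀ n → map joinₜ (join-tuples n) ↭ partitionsNC (suc n)
  joinₜ-↭ n = ∼bag⇒↭ (unique∧set⇒bag
    (Unique.map⁺ joinₜ-injective (join-tuples-unique n)) (partitionsNC-unique (suc n)) (mk⇔ to from))
    where
    to : ∀ {ρ} → ρ ∈ˡ map joinₜ (join-tuples n) → ρ ∈ˡ partitionsNC (suc n)
    to ρ∈ = let t , t∈ , e = ∈-map⁻ joinₜ ρ∈ ; ncα , ncβ = join-tuples-sound t t∈ in
      subst (_∈ˡ partitionsNC (suc n)) (sym e) (partitionsNC-complete (joinₜ t) (joinₜ-NC t ncα ncβ))

    from : ∀ {ρ} → ρ ∈ˡ partitionsNC (suc n) → ρ ∈ˡ map joinₜ (join-tuples n)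
    from {ρ} ρ∈ = let t , t∈ , e = joinₜ-surjective ρ (partitionsNC-sound ρ ρ∈) in
      subst (_∈ˡ map joinₜ (join-tuples n)) (sym e) (∈-map⁺ joinₜ t∈)

  find-nothing : ∀ {A : Set} {P : A → Set} (P? : Decidable P) {xs} → All (¬_ ∘ P) xs → List.find P? xs ≡ nothing
  find-nothing P? []         = refl
  find-nothing P? {x ∷ xs} (¬px ∷ ¬pxs) rewrite dec-false (P? x) ¬px = find-nothing P? ¬pxs

  ≐-sym : ∀ {n} {Bs Cs : List (Subset n)} → Bs ≐ Cs → Cs ≐ Bs
  ≐-sym (⊆ , ⊇) = ⊇ , ⊆

  ≐-trans : ∀ {n} {As Bs Cs : List (Subset n)} → As ≐ Bs → Bs ≐ Cs → As ≐ Cs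
  ≐-trans (⊆ , ⊇) (⊆′ , ⊇′) = (λ m → ⊆′ (⊆ m)) , (λ m → ⊇ (⊇′ m))

  ∣S++∅∣ : ∀ {g} (S : Subset g) h → ∣ S Vec.++ ∅ {h} ∣ ≡ ∣ S ∣
  ∣S++∅∣ []            h = ∣⊥∣≡0 h
  ∣S++∅∣ (inside  ∷ S) h = cong suc (∣S++∅∣ S h)
  ∣S++∅∣ (outside ∷ S) h = ∣S++∅∣ S h

  ∣∅++T∣ : ∀ g {h} (T : Subset h) → ∣ ∅ {g} Vec.++ T ∣ ≡ ∣ T ∣
  ∣∅++T∣ zero    T = refl
  ∣∅++T∣ (suc g) T = ∣∅++T∣ g T

open SetPartitions

-- Generating functions

module ListSums {r ℓ} (R : CommutativeRing r ℓ) where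

  open CommutativeRing R hiding (zero)
  open import Algebra.Properties.CommutativeSemigroup +-commutativeSemigroup
    using () renaming (x∙yz≈y∙xz to +-left-swap)
  open import Relation.Binary.Reasoning.Setoid setoid

  ∑ ∏ : ∀ {A : Set} → (A → Carrier) → List A → Carrier
  ∑ f xs = foldr _+_ 0# (map f xs)
  ∏ f xs = foldr _*_ 1# (map f xs)

  module _ {A : Set} where

    ∑-cong : ∀ {f g : A → Carrier} xs → (∀ {x} → x ∈ˡ xs → f x ≈ g x) → ∑ f xs ≈ ∑ g xs
    ∑-cong []       e = refl
    ∑-cong (x ∷ xs) e = +-cong (e (here ≡.refl)) (∑-cong xs (e ∘ there))

    ∏-cong : ∀ {f g : A → Carrier} xs → (∀ {x} → x ∈ˡ xs → f x ≈ g x) → ∏ f xs ≈ ∏ g xs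
    ∏-cong []       e = refl
    ∏-cong (x ∷ xs) e = *-cong (e (here ≡.refl)) (∏-cong xs (e ∘ there))

    ∑-++ : ∀ (f : A → Carrier) xs ys → ∑ f (xs List.++ ys) ≈ ∑ f xs + ∑ f ys
    ∑-++ f []       ys = sym (+-identityˡ _)
    ∑-++ f (x ∷ xs) ys = trans (+-congˡ (∑-++ f xs ys)) (sym (+-assoc _ _ _))

    ∏-++ : ∀ (f : A → Carrier) xs ys → ∏ f (xs List.++ ys) ≈ ∏ f xs * ∏ f ys
    ∏-++ f []       ys = sym (*-identityˡ _)
    ∏-++ f (x ∷ xs) ys = trans (*-congˡ (∏-++ f xs ys)) (sym (*-assoc _ _ _))

    ∑-↭ : ∀ (f : A → Carrier) {xs ys} → xs ↭ ys → ∑ f xs ≈ ∑ f ys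
    ∑-↭ f Perm.refl          = refl
    ∑-↭ f (prep x p)         = +-congˡ (∑-↭ f p)
    ∑-↭ f (Perm.swap x y p)       = trans (+-left-swap _ _ _) (+-congˡ (+-congˡ (∑-↭ f p)))
    ∑-↭ f (Perm.trans p q)   = trans (∑-↭ f p) (∑-↭ f q)

    ∑-0 : ∀ (xs : List A) → ∑ (λ _ → 0#) xs ≈ 0#
    ∑-0 []       = refl
    ∑-0 (x ∷ xs) = trans (+-identityˡ _) (∑-0 xs)

    *-distribˡ-∑ : ∀ a (f : A → Carrier) xs → a * ∑ f xs ≈ ∑ (λ x → a * f x) xs
    *-distribˡ-∑ a f []       = zeroʳ a
    *-distribˡ-∑ a f (x ∷ xs) = trans (distribˡ _ _ _) (+-congˡ (*-distribˡ-∑ a f xs))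

    -- As `y` occurs just once, the only term in which the two sums differ can be split off. This is
    -- the induction step of `∑-find`.
    ∑-update : ∀ {f g : A → Carrier} {w y xs} → Unique xs → y ∈ˡ xs → f y ≈ w → g y ≈ 0# →
      (∀ {x} → x ≢ y → f x ≈ g x) → ∑ f xs ≈ w + ∑ g xs
    ∑-update {f} {g} {w} {y} {x ∷ xs} (x∉ ∷ xs!) (here ≡.refl) fy gy e = +-cong fy (begin
      ∑ f xs        ≈⟨ ∑-cong xs (λ z∈ → e (λ z≡y → All.lookup x∉ z∈ (≡.sym z≡y))) ⟩
      ∑ g xs        ≈⟨ +-identityˡ _ ⟨
      0# + ∑ g xs   ≈⟨ +-congʳ gy ⟨
      g y + ∑ g xs  ∎)
    ∑-update {f} {g} {w} {y} {x ∷ xs} (x∉ ∷ xs!) (there y∈) fy gy e =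
      trans (+-cong (e (All.lookup x∉ y∈)) (∑-update xs! y∈ fy gy e)) (+-left-swap _ _ _)

  module _ {A B : Set} where

    ∑-map : ∀ (f : B → Carrier) (g : A → B) xs → ∑ f (map g xs) ≡ ∑ (f ∘ g) xs
    ∑-map f g xs = ≡.cong (foldr _+_ 0#) (≡.sym (List.map-∘ xs))

    ∏-map : ∀ (f : B → Carrier) (g : A → B) xs → ∏ f (map g xs) ≡ ∏ (f ∘ g) xs
    ∏-map f g xs = ≡.cong (foldr _*_ 1#) (≡.sym (List.map-∘ xs))

    ∑-concatMap : ∀ (f : B → Carrier) (g : A → List B) xs → ∑ f (concatMap g xs) ≈ ∑ (λ x → ∑ f (g x)) xs
    ∑-concatMap f g []       = refl
    ∑-concatMap f g (x ∷ xs) = trans (∑-++ f (g x) (concatMap g xs)) (+-congˡ (∑-concatMap f g xs))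

    -- Each x contributes through the single y to which it is matched; unmatched y contribute 0.
    ∑-find : {Q : A → B → Set} (Q? : ∀ y → Decidable (λ x → Q x y)) (w : A → Carrier) →
      ∀ {xs ys} → Unique xs → Unique ys → (∀ {x} → x ∈ˡ xs → ∃ λ y → y ∈ˡ ys × Q x y) →
      (∀ {x x′ y} → x ∈ˡ xs → x′ ∈ˡ xs → Q x y → Q x′ y → x ≡ x′) → (∀ {x y y′} → Q x y → Q x y′ → y ≡ y′) →
      ∑ (λ y → maybe′ w 0# (List.find (Q? y) xs)) ys ≈ ∑ w xs
    ∑-find Q? w {[]} {ys} [] ys! match inj fun = ∑-0 ys
    ∑-find Q? w {x ∷ xs} {ys} (x∉ ∷ xs!) ys! match inj fun with match (here ≡.refl)
    -- Dropping `x` from the searched list affects only the summand at `y`, and there the shorter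
    -- search fails, since no other listed element matches `y`.
    ... | y , y∈ , Qxy = trans
      (∑-update ys! y∈ (hit Qxy) (reflexive (≡.cong (maybe′ w 0#) (find-nothing (Q? y) (All.tabulate λ x′∈ Qx′y →
        All.lookup x∉ x′∈ (inj (here ≡.refl) (there x′∈) Qxy Qx′y))))) (λ z≢y → miss (λ Qxz → z≢y (fun Qxz Qxy))))
      (+-congˡ (∑-find Q? w xs! ys! (match ∘ there) (λ x∈ x′∈ → inj (there x∈) (there x′∈)) fun))
      where
      hit : ∀ {y} → _ → maybe′ w 0# (List.find (Q? y) (x ∷ xs)) ≈ w x
      hit {y} Qxy rewrite dec-true (Q? y x) Qxy = refl

      miss : ∀ {y} → ¬ _ → maybe′ w 0# (List.find (Q? y) (x ∷ xs)) ≈ maybe′ w 0# (List.find (Q? y) xs)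
      miss {y} ¬Qxy rewrite dec-false (Q? y x) ¬Qxy = refl

  ∑-cartesianProductWith : ∀ {A B C : Set} {F : C → Carrier} {f : A → Carrier} {g : B → Carrier} {_∙_ : A → B → C} →
    (∀ x y → F (x ∙ y) ≈ f x * g y) → ∀ xs ys → ∑ F (cartesianProductWith _∙_ xs ys) ≈ ∑ f xs * ∑ g ys
  ∑-cartesianProductWith e []       ys = sym (zeroˡ _)
  ∑-cartesianProductWith {F = F} {f} {g} {_∙_} e (x ∷ xs) ys = begin
    ∑ F (map (x ∙_) ys List.++ cartesianProductWith _∙_ xs ys)
      ≈⟨ ∑-++ F (map (x ∙_) ys) _ ⟩
    ∑ F (map (x ∙_) ys) + ∑ F (cartesianProductWith _∙_ xs ys)
      ≈⟨ +-cong (reflexive (∑-map F (x ∙_) ys)) (∑-cartesianProductWith {F = F} {f} {g} {_∙_} e xs ys) ⟩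
    ∑ (λ y → F (x ∙ y)) ys + ∑ f xs * ∑ g ys
      ≈⟨ +-congʳ (trans (∑-cong ys (λ {y} _ → e x y)) (sym (*-distribˡ-∑ (f x) g ys))) ⟩
    f x * ∑ g ys + ∑ f xs * ∑ g ys
      ≈⟨ distribʳ _ _ _ ⟨
    (f x + ∑ f xs) * ∑ g ys ∎

  ∑-choices : ∀ {A : Set} {P : A → Set} (f : ∀ x → List (P x)) (w : ∀ {x} → P x → Carrier) xs →
    ∑ (λ ps → foldr _*_ 1# (All.reduce w ps)) (choices f xs) ≈ ∏ (λ x → ∑ w (f x)) xs
  ∑-choices f w []       = +-identityʳ _
  ∑-choices f w (x ∷ xs) = trans
    (∑-cartesianProductWith {F = λ ps → foldr _*_ 1# (All.reduce w ps)} {f = w} {_∙_ = _∷_}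
      (λ _ _ → refl) (f x) (choices f xs))
    (*-congˡ (∑-choices f w xs))

-- The functional equation for D

module GeneratingFunctions {r ℓ} (R : CommutativeRing r ℓ) (a : ∀ {n} → Partition n → CommutativeRing.Carrier R) where

  open CommutativeRing R hiding (zero)
  open PowerSeries R
  open Weights R a
  open ListSums R
  open SeriesProperties R
  open import Algebra.Properties.CommutativeSemigroup *-commutativeSemigroup
    using () renaming (x∙yz≈y∙xz to *-left-swap)
  open import Relation.Binary.Reasoning.Setoid setoid

  blockProduct : ∀ {n} → List (Subset n) → Carrier
  blockProduct = ∏ (C ∘ ∣_∣)

  N : Series
  N n = ∑ (blockProduct ∘ blocks) (partitionsNC n)

  -- `C` unfolds to its sum only at a successor. A point of `Fin n` exposes one, and each nonempty
  -- block provides such a point.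
  C-nonempty : ∀ {n} → Fin n → C n ≡ ∑ c (filter co? (partitions n))
  C-nonempty {suc n} _ = ≡.refl

  𝟙⊕C-nonempty : ∀ {n} → Fin n → (𝟙 ⊕ C) n ≈ C n
  𝟙⊕C-nonempty {suc n} _ = +-identityˡ _

  ∑-d≈N : ∀ n → ∑ d (partitions n) ≈ N n
  ∑-d≈N n = begin
    ∑ d (partitions n)
      -- The tuples are the elements searched for and the partitions index the sum: `Ψ-partition`
      -- supplies the partition that finds a given tuple, and canonicity of `blocks` makes it
      -- unique.
      ≈⟨ ∑-find (λ π t → Ψ t ≐? blocks π) weight (Ψ-tuples-unique n) (partitions-unique n)
           (λ {t} _ → let π , e = Ψ-partition t in π , partitions-complete π , e)
           (λ {t} {t′} {π} t∈ t′∈ e e′ → inj {t} {t′} {π} t∈ t′∈ e e′)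
           (λ {t} {π} {ρ} e e′ → ≐⇒≡ {π = π} {ρ} (≐-trans (≐-sym e) e′)) ⟩
    ∑ weight (Ψ-tuples n)
      ≈⟨ ∑-concatMap weight _ (partitionsNC n) ⟩
    ∑ (λ τ → ∑ weight (map (τ ,_) (choices (λ B → filter co? (partitions ∣ B ∣)) (blocks τ)))) (partitionsNC n)
      ≈⟨ ∑-cong (partitionsNC n) (λ {τ} _ → begin
           ∑ weight (map (τ ,_) (choices (λ B → filter co? (partitions ∣ B ∣)) (blocks τ)))
             ≡⟨ ∑-map weight (τ ,_) (choices _ (blocks τ)) ⟩
           ∑ (λ σs → weight (τ , σs)) (choices (λ B → filter co? (partitions ∣ B ∣)) (blocks τ))
             ≈⟨ ∑-choices (λ B → filter co? (partitions ∣ B ∣)) c (blocks τ) ⟩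
           ∏ (λ B → ∑ c (filter co? (partitions ∣ B ∣))) (blocks τ)
             ≈⟨ ∏-cong (blocks τ) (λ {B} B∈ → reflexive (≡.sym (C-nonempty (proj₁ (ψ-surjective (proj₂ (nonempty τ B∈))))))) ⟩
           blockProduct (blocks τ) ∎) ⟩
    N n ∎
    where
    weight : ΨTuple n → Carrier
    weight t = ∏-over (All.reduce c (proj₂ t))

    inj : ∀ {t t′ π} → t ∈ˡ Ψ-tuples n → t′ ∈ˡ Ψ-tuples n → Ψ t ≐ blocks π → Ψ t′ ≐ blocks {n} π → t ≡ t′
    inj {t} {t′} t∈ t′∈ t≐π t′≐π =
      let nc , co = Ψ-tuples-sound t∈ ; nc′ , co′ = Ψ-tuples-sound t′∈ ; t≐t′ = ≐-trans t≐π (≐-sym t′≐π)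
      in Ψ-injective₂ t t′ (Ψ-injective₁ t t′ nc co nc′ co′ t≐t′) t≐t′

  N0 : N 0 ≈ 1#
  N0 = +-identityʳ 1#

  D≋N : D ≋ N
  D≋N zero    = sym N0
  D≋N (suc n) = ∑-d≈N (suc n)

  -- The value `f 0` on the empty list counts the absent head as a block of size 0, in agreement
  -- with the default of `hd`.
  headWeight : ∀ {n} → Series → List (Subset n) → Carrier
  headWeight f []       = f 0
  headWeight f (B ∷ Bs) = f ∣ B ∣ * blockProduct Bs

  W : Series → Series
  W f n = ∑ (headWeight f ∘ blocks) (partitionsNC n)

  W-zero : ∀ f → W f 0 ≈ f 0
  W-zero f = +-identityʳ (f 0)

  -- `𝟙 ⊕ C` agrees with `C` at the sizes of actual blocks, and its constant term 1 is the empty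
  -- product for the partition of the empty set.
  N≋W : N ≋ W (𝟙 ⊕ C)
  N≋W n = ∑-cong (partitionsNC n) λ {τ} _ → go (blocks τ) (nonempty τ)
    where
    go : ∀ {n} (Bs : List (Subset n)) → (∀ {B} → B ∈ˡ Bs → Nonempty B) → blockProduct Bs ≈ headWeight (𝟙 ⊕ C) Bs
    go []       _  = sym (+-identityʳ 1#)
    go (B ∷ Bs) ne = *-congʳ (sym (𝟙⊕C-nonempty (proj₁ (ψ-surjective (proj₂ (ne (here ≡.refl)))))))

  -- The root block has one element more than the head of `Bs`, which turns `f` into `tail f`; all
  -- other blocks keep their sizes.
  headWeight-join : ∀ f {g h} (As : List (Subset g)) (Bs : List (Subset h)) →
    headWeight f (joinBlocks As Bs) ≈ blockProduct As * headWeight (tail f) Bs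
  headWeight-join f {g} {h} As Bs = begin
    f (suc ∣ ∅ {g} Vec.++ hd Bs ∣) * blockProduct (map leftBlock As List.++ map rightBlock (tl Bs))
      ≈⟨ *-cong (reflexive (≡.cong (f ∘ suc) (∣∅++T∣ g (hd Bs)))) (trans (∏-++ _ (map leftBlock As) _) (*-cong
           (trans (reflexive (∏-map (C ∘ ∣_∣) leftBlock As)) (∏-cong As λ {A} _ → reflexive (≡.cong C (∣S++∅∣ A h))))
           (trans (reflexive (∏-map (C ∘ ∣_∣) rightBlock (tl Bs))) (∏-cong (tl Bs) λ {B} _ → reflexive (≡.cong C (∣∅++T∣ g B)))))) ⟩
    f (suc ∣ hd Bs ∣) * (blockProduct As * blockProduct (tl Bs))
      ≈⟨ *-left-swap _ _ _ ⟩
    blockProduct As * (f (suc ∣ hd Bs ∣) * blockProduct (tl Bs))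
      ≈⟨ *-congˡ (head-tail Bs) ⟩
    blockProduct As * headWeight (tail f) Bs ∎
    where
    head-tail : ∀ {h} (Bs : List (Subset h)) → f (suc ∣ hd Bs ∣) * blockProduct (tl Bs) ≈ headWeight (tail f) Bs
    head-tail {h} []       = trans (*-identityʳ _) (reflexive (≡.cong (f ∘ suc) (∣⊥∣≡0 h)))
    head-tail     (_ ∷ _)  = refl

  ⊛≈∑-splits : ∀ n f g → (f ⊛ g) n ≈ ∑ (λ (i , j , _) → f i * g j) (splits n)
  ⊛≈∑-splits zero    f g = refl
  ⊛≈∑-splits (suc n) f g = +-congˡ (trans (⊛≈∑-splits n (tail f) g)
    (reflexive (≡.sym (∑-map (λ (i , j , _) → f i * g j) shift (splits n)))))

  -- The blocks in the gap all carry the weight `C`, which gives the factor `N`; the distinguished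
  -- weight passes to the head of the other part.
  W-suc : ∀ f n → W f (suc n) ≈ (N ⊛ W (tail f)) n
  W-suc f n = begin
    ∑ (headWeight f ∘ blocks) (partitionsNC (suc n))
      ≈⟨ ∑-↭ (headWeight f ∘ blocks) (joinₜ-↭ n) ⟨
    ∑ (headWeight f ∘ blocks) (map joinₜ (join-tuples n))
      ≡⟨ ∑-map (headWeight f ∘ blocks) joinₜ (join-tuples n) ⟩
    ∑ (headWeight f ∘ blocks ∘ joinₜ) (join-tuples n)
      ≈⟨ ∑-concatMap (headWeight f ∘ blocks ∘ joinₜ) _ (splits n) ⟩
    ∑ (λ s@(g , h , _) → ∑ (headWeight f ∘ blocks ∘ joinₜ) (map (s ,_) (cartesianProduct (partitionsNC g) (partitionsNC h)))) (splits n)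
      ≈⟨ ∑-cong (splits n) (λ {s@(g , h , _)} _ → trans
           (reflexive (∑-map (headWeight f ∘ blocks ∘ joinₜ) (s ,_) (cartesianProduct (partitionsNC g) (partitionsNC h))))
           (∑-cartesianProductWith {F = λ αβ → headWeight f (blocks (joinₜ (s , αβ)))}
             {blockProduct ∘ blocks} {headWeight (tail f) ∘ blocks} {_,_} (joinₜ-weight s) (partitionsNC g) (partitionsNC h))) ⟩
    ∑ (λ (g , h , _) → N g * W (tail f) h) (splits n)
      ≈⟨ ⊛≈∑-splits n N (W (tail f)) ⟨
    (N ⊛ W (tail f)) n ∎
    where
    joinₜ-weight : ∀ {n} (s@(g , h , _) : Split n) (α : Partition g) (β : Partition h) →
      headWeight f (blocks (joinₜ (s , α , β))) ≈ blockProduct (blocks α) * headWeight (tail f) (blocks β)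
    joinₜ-weight (g , h , ≡.refl) α β = headWeight-join f (blocks α) (blocks β)

  -- Both sides have constant term `f 0`, and in positive degree both are `N` times their value at
  -- `tail f`, one degree lower. The induction on the degree is therefore over all `f` at once.
  W≋⟨⟩ : ∀ f → W f ≋ f ⟨ X ⊛ N ⟩
  W≋⟨⟩ f n = below (suc n) f n ℕ.≤-refl
    where
    XN0 : (X ⊛ N) 0 ≈ 0#
    XN0 = X⊛-zero N

    below : ∀ m f n → n < m → W f n ≈ (f ⟨ X ⊛ N ⟩) n
    below (suc m) f zero    _ = trans (W-zero f) (sym (⟨⟩-zero (X ⊛ N) XN0 f))
    below (suc m) f (suc n) (s≤s n<m) = begin
      W f (suc n)
        ≈⟨ W-suc f n ⟩
      (N ⊛ W (tail f)) n
        ≈⟨ ⊛-cong-≤ n {N} {N} {W (tail f)} {tail f ⟨ X ⊛ N ⟩} (λ _ _ → refl)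
             (λ i i≤n → below m (tail f) i (ℕ.≤-trans (s≤s i≤n) n<m)) ⟩
      (N ⊛ tail f ⟨ X ⊛ N ⟩) n
        ≈⟨ ⊛-congʳ (tail f ⟨ X ⊛ N ⟩) (X⊛-suc N) n ⟨
      (tail (X ⊛ N) ⊛ tail f ⟨ X ⊛ N ⟩) n
        ≈⟨ 0≈⇒⊛-suc (X ⊛ N) XN0 (tail f ⟨ X ⊛ N ⟩) n ⟨
      (X ⊛ N ⊛ tail f ⟨ X ⊛ N ⟩) (suc n)
        ≈⟨ +-identityˡ _ ⟨
      0# + (X ⊛ N ⊛ tail f ⟨ X ⊛ N ⟩) (suc n)
        ≈⟨ +-congʳ (zeroʳ (f 0)) ⟨
      f 0 * 0# + (X ⊛ N ⊛ tail f ⟨ X ⊛ N ⟩) (suc n)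
        ≈⟨ ⟨⟩-horner (X ⊛ N) XN0 f (suc n) ⟨
      (f ⟨ X ⊛ N ⟩) (suc n) ∎

  D-equation : D ≋ 𝟙 ⊕ C ⟨ X ⊛ D ⟩
  D-equation n = begin
    D n                                     ≈⟨ D≋N n ⟩
    N n                                     ≈⟨ N≋W n ⟩
    W (𝟙 ⊕ C) n                             ≈⟨ W≋⟨⟩ (𝟙 ⊕ C) n ⟩
    ((𝟙 ⊕ C) ⟨ X ⊛ N ⟩) n                   ≈⟨ ⟨⟩-congʳ (𝟙 ⊕ C) (⊛-congˡ X D≋N) n ⟨
    ((𝟙 ⊕ C) ⟨ X ⊛ D ⟩) n                   ≈⟨ ⟨⟩-⊕ (X ⊛ D) (X⊛-zero D) 𝟙 C n ⟩
    (𝟙 ⟨ X ⊛ D ⟩) n + (C ⟨ X ⊛ D ⟩) n       ≈⟨ +-congʳ (𝟙⟨⟩ (X ⊛ D) (X⊛-zero D) n) ⟩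
    𝟙 n + (C ⟨ X ⊛ D ⟩) n                   ∎

lemma2p12 : ∀ {r ℓ} (R : CommutativeRing r ℓ) (a : ∀ {n} → Partition n → CommutativeRing.Carrier R) →
    let open PowerSeries R
        open Weights R a
        F = X ⊛ D
    in (D ≋ 𝟙 ⊕ C ⟨ X ⊛ D ⟩)
     × IsCompositionalInverse F (X ⊘ (𝟙 ⊕ C))
     × (∀ G → IsCompositionalInverse F G → G ≋ X ⊘ (𝟙 ⊕ C))
lemma2p12 R a = D-equation , compositionalInverse refl D-equation , compositionalInverse-unique refl D-equation
  where
  open CommutativeRing R using (refl)
  open SeriesProperties R
  open GeneratingFunctions R a
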